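{- Fix an odd prime $p$. For each $n$ let $m=m(n)$ be a nonnegative integer with $m\leq\binom{n+1}{2}-11n\log_p n$, and let $S=\{d_1,\dots,d_m\}\subseteq\mathbb F_p^n$ where $d_1,\dots,d_m$ are chosen independently and uniformly at random from $\mathbb F_p^n$. Then, with probability tending to $1$ as $n\to\infty$, there exists an $n\times n$ matrix $M$ over $\mathbb F_p$ such that $d^\top Md\neq0$ for all $d\in S$. -}

module Defs where

open import Data.Bool using (Bool; not; _∧_)
open import Data.Nat using (ℕ; zero; suc; _+_; _*_; _∸_; _^_; _≤_; _%_; _≡ᵇ_; NonZero)
open import Data.Nat.Combinatorics using (_C_)
open import Data.Fin using (Fin; toℕ)
open import Data.List using (List; []; _∷_; map; concatMap; length; filterᵇ; allFin)
open import Data.Bool.ListAction using (any)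
open import Data.Vec as V using (Vec)

vecs : {A : Set} → List A → (n : ℕ) → List (Vec A n)
vecs xs zero = V.[] ∷ []
vecs xs (suc n) = concatMap (λ x → map (x V.∷_) (vecs xs n)) xs

-- F_p is modelled as Fin p (residues 0..p-1), arithmetic done in ℕ and reduced mod p.
Vecp : ℕ → ℕ → Set
Vecp p n = Vec (Fin p) n

Matp : ℕ → ℕ → Set
Matp p n = Vec (Vec (Fin p) n) n   -- rows

points : (p n : ℕ) → List (Vecp p n)
points p n = vecs (allFin p) n

matrices : (p n : ℕ) → List (Matp p n)
matrices p n = vecs (points p n) n

sumV : {k : ℕ} → Vec ℕ k → ℕ
sumV = V.foldr _ _+_ 0

quadForm : {p n : ℕ} → Matp p n → Vecp p n → ℕ
quadForm M d =
  let dv = V.map toℕ d in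
  sumV (V.zipWith (λ di row → di * sumV (V.zipWith _*_ (V.map toℕ row) dv)) dv M)

nonzeroQF : (p : ℕ) .{{_ : NonZero p}} {n : ℕ} → Matp p n → Vecp p n → Bool
nonzeroQF p M d = not ((quadForm M d % p) ≡ᵇ 0)

goodTuple : (p : ℕ) .{{_ : NonZero p}} {n m : ℕ} → Vec (Vecp p n) m → Bool
goodTuple p {n} ds = any (λ M → V.foldr _ (λ d b → nonzeroQF p M d ∧ b) Bool.true ds) (matrices p n)
  where import Data.Bool as Bool

goodCount : (p : ℕ) .{{_ : NonZero p}} (n m : ℕ) → ℕ
goodCount p n m = length (filterᵇ (goodTuple p) (vecs (points p n) m))

-- total number of m-tuples: |F_p^n|^m = p^(n m)
totalCount : (p n m : ℕ) → ℕ
totalCount p n m = p ^ (n * m)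

-- m ≤ binom(n+1,2) - 11 n log_p n, stated exactly without reals
-- (for n ≥ 1, log_p n ≥ 0, so this is: m ≤ C and n^(11n) ≤ p^(C - m), C = binom(n+1,2))
MBound : (p n m : ℕ) → Set
MBound p n m = (m ≤ (suc n) C 2) × (n ^ (11 * n) ≤ p ^ ((suc n) C 2 ∸ m))
  where open import Data.Product using (_×_)

{-# OPTIONS --safe #-}

-- Let 𝒰 be the space of upper triangular forms U, of size p^C with C = binom(n+1,2), and put P = pⁿ.
-- For a tuple ds the number of U vanishing on all of ds is at least |𝒰|/pᵐ, and at least 2|𝒰|/pᵐ
-- when the vector (1,…,1) is not a value of U ↦ (U(d₁),…,U(dₘ)).  Hence the proportion of bad tuples
-- is at most E_U (p Z(U)/P)ᵐ − 1, where Z(U) is the number of zeros of U.  Weyl differencing bounds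
-- p Z(U)/P by 1 + 1/T unless p^(rank) = O(T²), where the rank is that of the symmetric matrix U + Uᵀ.
-- With T a large multiple of n² the exceptional U have rank at most 4 log_p n + O(1), so there are at most
-- p^(2·rank·n + O(n)) = n^(8n) 2^O(n) ≪ n^(11n) ≤ p^(C−m) of them, and the expectation is 1 + o(1).
module Submission where

open import Defs
open import Algebra.Bundles using (CommutativeRing)
import Algebra.Properties.AbelianGroup as AbelianGroupProperties
open import Algebra.Structures using (IsCommutativeRing)
import Algebra.Solver.Ring.NaturalCoefficients.Default as NaturalCoefficients
open import Data.Bool using (Bool; true; false; _∧_; if_then_else_)
open import Data.Bool.ListAction using (any)
open import Data.Bool.Properties using (∨-zeroʳ)
open import Data.Fin using (Fin; zero; suc; toℕ; fromℕ<)
import Data.Fin.Properties as Fin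
open import Data.List using (List; []; _∷_; _++_; map; concatMap; tabulate; allFin; length; filterᵇ)
open import Data.List.Properties using (map-++; map-tabulate; map-∘; map-cong; tabulate-cong; length-tabulate)
open import Data.Nat using (ℕ; zero; suc; _+_; _*_; _∸_; _^_; _%_; _⊔_; _≤_; _<_; _≥_; z≤n; s≤s; _≤?_; NonZero; >-nonZero; >-nonZero⁻¹; ≢-nonZero; nonTrivial⇒n>1) renaming (_≟_ to _ℕ≟_)
open import Data.Nat.Combinatorics using (_C_; nC1≡n; nCk+nC[k+1]≡[n+1]C[k+1])
open import Data.Nat.Coprimality using (prime⇒coprime; coprime-Bézout)
open import Data.Nat.Divisibility using (_∣_; m%n≡0⇒n∣m; divides; ∣⇒≤)
open import Data.Nat.DivMod using (m%n<n; n%n≡0; m*n%n≡0; m<n⇒m%n≡m; %-distribˡ-+; %-distribˡ-*; [m+kn]%n≡m%n)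
open import Data.Nat.GCD using (module Bézout)
open import Data.Nat.ListAction using (sum)
open import Data.Nat.ListAction.Properties using (sum-++)
open import Data.Nat.Primality using (Prime; prime⇒nonTrivial)
open import Data.Nat.Properties hiding (_≟_)
open import Data.Nat.Tactic.RingSolver using () renaming (solve-∀ to ℕ-solve-∀)
open import Data.Product using (∃; ∃-syntax; _×_; _,_; proj₁; proj₂)
open import Data.Sum using (_⊎_; inj₁; inj₂)
open import Data.Vec as Vec using (Vec; []; _∷_; replicate; zipWith; foldr)
import Data.Vec.Properties as Vec
open import Function using (_∘_; id)
open import Relation.Binary.Definitions using (DecidableEquality)
open import Relation.Binary.PropositionalEquality
open import Relation.Nullary using (¬_; Dec; yes; no; contradiction; _×-dec_; ¬?)
open import Relation.Nullary.Decidable using (map′)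

-- Finite sums

-- Subtracting 1 from the expectation leaves no room for a loss of a constant factor: it has to be
-- bounded by 1 + 1/(k+1) for every k. A form of high rank is only known to contribute at most (1 +
-- 1/T)^m, and m may be of order n², so T has to exceed n² by a factor that grows with k; this is
-- what makes the rank cut-off depend on log n. Forms below the cut-off get the trivial bound p^m
-- each, and the gap between m and C pays for them. The target (1,...,1) is one convenient vector
-- without zero entries: reaching it already makes a tuple good, and missing it already doubles the
-- kernel. Triangular matrices represent each form once, so their number is exactly p^C; since p is
-- odd, `U` can be recovered from U + Uᵀ, and degenerate forms can be counted as matrices of low
-- rank. Dimensions are avoided throughout. A subspace enters through its number of elements, a rank
-- through the number of kernel vectors, a logarithm through a power of q lying between two bounds,
-- and every inequality between ratios is cross-multiplied into ℕ.

⟦_⟧ : {P : Set} → Dec P → ℕ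
⟦ yes _ ⟧ = 1
⟦ no _ ⟧ = 0

⟦⟧-mono : {P Q : Set} (p? : Dec P) (q? : Dec Q) → (P → Q) → ⟦ p? ⟧ ≤ ⟦ q? ⟧
⟦⟧-mono (no _) _ _ = z≤n
⟦⟧-mono (yes p) (yes q) _ = ≤-refl
⟦⟧-mono (yes p) (no ¬q) f = contradiction (f p) ¬q

⟦⟧-cong : {P Q : Set} (p? : Dec P) (q? : Dec Q) → (P → Q) → (Q → P) → ⟦ p? ⟧ ≡ ⟦ q? ⟧
⟦⟧-cong p? q? f g = ≤-antisym (⟦⟧-mono p? q? f) (⟦⟧-mono q? p? g)

⟦⟧≤1 : {P : Set} (p? : Dec P) → ⟦ p? ⟧ ≤ 1
⟦⟧≤1 (yes _) = ≤-refl
⟦⟧≤1 (no _) = z≤n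

⟦⟧-yes : {P : Set} (p? : Dec P) → P → ⟦ p? ⟧ ≡ 1
⟦⟧-yes (yes _) _ = refl
⟦⟧-yes (no ¬p) p = contradiction p ¬p

⟦⟧-no : {P : Set} (p? : Dec P) → ¬ P → ⟦ p? ⟧ ≡ 0
⟦⟧-no (yes p) ¬p = contradiction p ¬p
⟦⟧-no (no _) _ = refl

⟦⟧-× : {P Q R : Set} (p? : Dec P) (q? : Dec Q) (r? : Dec R) →
  (R → P × Q) → (P → Q → R) → ⟦ r? ⟧ ≡ ⟦ p? ⟧ * ⟦ q? ⟧
⟦⟧-× (yes p) (yes q) r? f g = ⟦⟧-yes r? (g p q)
⟦⟧-× (yes p) (no ¬q) r? f g = ⟦⟧-no r? (¬q ∘ proj₂ ∘ f)
⟦⟧-× (no ¬p) q? r? f g = ⟦⟧-no r? (¬p ∘ proj₁ ∘ f)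

module _ {A : Set} where

  ∑ₗ : List A → (A → ℕ) → ℕ
  ∑ₗ xs f = sum (map f xs)

  ∑ₗ-mono : ∀ xs {f g : A → ℕ} → (∀ x → f x ≤ g x) → ∑ₗ xs f ≤ ∑ₗ xs g
  ∑ₗ-mono [] h = z≤n
  ∑ₗ-mono (x ∷ xs) h = +-mono-≤ (h x) (∑ₗ-mono xs h)

  ∑ₗ-cong : ∀ xs {f g : A → ℕ} → (∀ x → f x ≡ g x) → ∑ₗ xs f ≡ ∑ₗ xs g
  ∑ₗ-cong xs h = cong sum (map-cong h xs)

  ∑ₗ-+ : ∀ xs (f g : A → ℕ) → ∑ₗ xs (λ x → f x + g x) ≡ ∑ₗ xs f + ∑ₗ xs g
  ∑ₗ-+ [] f g = refl
  ∑ₗ-+ (x ∷ xs) f g = trans (cong (f x + g x +_) (∑ₗ-+ xs f g)) (+-interchange (f x) (g x) _ _)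
    where
    open import Algebra.Properties.CommutativeSemigroup +-commutativeSemigroup
      using () renaming (interchange to +-interchange)

  ∑ₗ-* : ∀ xs (f : A → ℕ) c → ∑ₗ xs (λ x → f x * c) ≡ ∑ₗ xs f * c
  ∑ₗ-* [] f c = refl
  ∑ₗ-* (x ∷ xs) f c = trans (cong (f x * c +_) (∑ₗ-* xs f c)) (sym (*-distribʳ-+ c (f x) _))

  ∑ₗ-0 : ∀ xs → ∑ₗ xs (λ _ → 0) ≡ 0
  ∑ₗ-0 [] = refl
  ∑ₗ-0 (x ∷ xs) = ∑ₗ-0 xs

  ∑ₗ-++ : ∀ xs ys (f : A → ℕ) → ∑ₗ (xs ++ ys) f ≡ ∑ₗ xs f + ∑ₗ ys f
  ∑ₗ-++ xs ys f = trans (cong sum (map-++ f xs ys)) (sum-++ (map f xs) (map f ys))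

  ∑ₗ-witness : ∀ xs (f : A → ℕ) → ∑ₗ xs f ≢ 0 → ∃ λ x → f x ≢ 0
  ∑ₗ-witness [] f ne = contradiction refl ne
  ∑ₗ-witness (x ∷ xs) f ne with f x in eq
  ... | suc _ = x , λ e → contradiction (trans (sym eq) e) λ ()
  ... | zero = ∑ₗ-witness xs f ne

module _ {A B : Set} where

  ∑ₗ-comm : ∀ (xs : List A) (ys : List B) (f : A → B → ℕ) →
    ∑ₗ xs (λ x → ∑ₗ ys (f x)) ≡ ∑ₗ ys (λ y → ∑ₗ xs (λ x → f x y))
  ∑ₗ-comm [] ys f = sym (∑ₗ-0 ys)
  ∑ₗ-comm (x ∷ xs) ys f =
    trans (cong (∑ₗ ys (f x) +_) (∑ₗ-comm xs ys f)) (sym (∑ₗ-+ ys (f x) _))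

  ∑ₗ-concatMap : ∀ (xs : List A) (h : A → List B) (f : B → ℕ) →
    ∑ₗ (concatMap h xs) f ≡ ∑ₗ xs (λ x → ∑ₗ (h x) f)
  ∑ₗ-concatMap [] h f = refl
  ∑ₗ-concatMap (x ∷ xs) h f =
    trans (∑ₗ-++ (h x) (concatMap h xs) f) (cong (∑ₗ (h x) f +_) (∑ₗ-concatMap xs h f))

  ∑ₗ-map : ∀ (xs : List A) (h : A → B) (f : B → ℕ) → ∑ₗ (map h xs) f ≡ ∑ₗ xs (f ∘ h)
  ∑ₗ-map xs h f = cong sum (sym (map-∘ xs))

-- Finite types, sums over them, and counting.

record Finite (A : Set) : Set where
  infix 4 _≟_
  field
    elems : List A
    _≟_ : DecidableEquality A
    once : ∀ a → ∑ₗ elems (λ x → ⟦ x ≟ a ⟧) ≡ 1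

open Finite ⦃ ... ⦄ public

module _ {A : Set} ⦃ _ : Finite A ⦄ where

  opaque
    ∑ : (A → ℕ) → ℕ
    ∑ = ∑ₗ elems

  # : {P : A → Set} → (∀ x → Dec (P x)) → ℕ
  # P? = ∑ λ x → ⟦ P? x ⟧

  opaque
    unfolding ∑

    ∑-mono : {f g : A → ℕ} → (∀ x → f x ≤ g x) → ∑ f ≤ ∑ g
    ∑-mono = ∑ₗ-mono elems

    ∑-cong : {f g : A → ℕ} → (∀ x → f x ≡ g x) → ∑ f ≡ ∑ g
    ∑-cong = ∑ₗ-cong elems

    ∑-+ : ∀ (f g : A → ℕ) → ∑ (λ x → f x + g x) ≡ ∑ f + ∑ g
    ∑-+ = ∑ₗ-+ elems

    ∑-*ʳ : ∀ (f : A → ℕ) c → ∑ (λ x → f x * c) ≡ ∑ f * c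
    ∑-*ʳ = ∑ₗ-* elems

    ∑-zero : ∑ (λ _ → 0) ≡ 0
    ∑-zero = ∑ₗ-0 elems

    ∑-once : ∀ a → # (_≟ a) ≡ 1
    ∑-once = once

    ∑-witness : ∀ (f : A → ℕ) → ∑ f ≢ 0 → ∃ λ x → f x ≢ 0
    ∑-witness = ∑ₗ-witness elems

  ∑-*ˡ : ∀ c (f : A → ℕ) → ∑ (λ x → c * f x) ≡ c * ∑ f
  ∑-*ˡ c f = trans (∑-cong λ x → *-comm c (f x)) (trans (∑-*ʳ f c) (*-comm (∑ f) c))

  ∑-δ : ∀ (f : A → ℕ) a → ∑ (λ x → ⟦ x ≟ a ⟧ * f x) ≡ f a
  ∑-δ f a = trans (∑-cong step) (trans (∑-*ʳ (λ x → ⟦ x ≟ a ⟧) (f a))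
    (trans (cong (_* f a) (∑-once a)) (*-identityˡ (f a))))
    where
    step : ∀ x → ⟦ x ≟ a ⟧ * f x ≡ ⟦ x ≟ a ⟧ * f a
    step x with x ≟ a
    ... | yes refl = refl
    ... | no _ = refl

  term≤∑ : ∀ (f : A → ℕ) a → f a ≤ ∑ f
  term≤∑ f a = subst (_≤ ∑ f) (∑-δ f a)
    (∑-mono λ x → ≤-trans (*-monoˡ-≤ (f x) (⟦⟧≤1 (x ≟ a))) (≤-reflexive (*-identityˡ (f x))))

  -- Takes the place of excluded middle in the later case distinctions, on kernel vectors and on
  -- preimages: a nonzero count yields a witness.
  search : {P : A → Set} (P? : ∀ x → Dec (P x)) → ∃ P ⊎ (∀ x → ¬ P x)
  search P? with # P? ℕ≟ 0
  ... | no ne with ∑-witness (λ x → ⟦ P? x ⟧) ne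
  ... | x , ne′ with P? x
  ... | yes p = inj₁ (x , p)
  ... | no _ = contradiction refl ne′
  search P? | yes e = inj₂ λ x p →
    contradiction (≤-trans (≤-reflexive (sym (⟦⟧-yes (P? x) p)))
                    (≤-trans (term≤∑ (λ y → ⟦ P? y ⟧) x) (≤-reflexive e))) λ ()

card : (A : Set) ⦃ _ : Finite A ⦄ → ℕ
card A = ∑ {A} λ _ → 1

module _ {A B : Set} ⦃ _ : Finite A ⦄ ⦃ _ : Finite B ⦄ where

  opaque
    unfolding ∑

    ∑-comm : ∀ (f : A → B → ℕ) → ∑ (λ x → ∑ (f x)) ≡ ∑ (λ y → ∑ (λ x → f x y))
    ∑-comm = ∑ₗ-comm elems elems

  -- Each y has at most one preimage, so exchanging the sums over x and y gives every `f y` a weight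
  -- of at most 1. Later comparisons of cardinalities rest on this, the injections being
  -- translations, differences and `symmetrise`.
  ∑-inject : (φ : A → B) → (∀ {x y} → φ x ≡ φ y → x ≡ y) → (f : B → ℕ) → ∑ (f ∘ φ) ≤ ∑ f
  ∑-inject φ inj f = begin
    ∑ (λ x → f (φ x))                       ≡⟨ ∑-cong (λ x → ∑-δ f (φ x)) ⟨
    ∑ (λ x → ∑ λ y → ⟦ y ≟ φ x ⟧ * f y)     ≡⟨ ∑-comm _ ⟩
    ∑ (λ y → ∑ λ x → ⟦ y ≟ φ x ⟧ * f y)     ≡⟨ ∑-cong (λ y → ∑-*ʳ (λ x → ⟦ y ≟ φ x ⟧) (f y)) ⟩
    ∑ (λ y → # (λ x → y ≟ φ x) * f y)       ≤⟨ ∑-mono (λ y → *-monoˡ-≤ (f y) (fibre y)) ⟩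
    ∑ (λ y → 1 * f y)                       ≡⟨ ∑-cong (λ y → *-identityˡ (f y)) ⟩
    ∑ f                                     ∎
    where
    open ≤-Reasoning
    fibre : ∀ y → # (λ x → y ≟ φ x) ≤ 1
    fibre y with search (λ x → y ≟ φ x)
    ... | inj₁ (x₀ , refl) = ≤-trans
      (∑-mono λ x → ⟦⟧-mono (y ≟ φ x) (x ≟ x₀) (inj ∘ sym)) (≤-reflexive (∑-once x₀))
    ... | inj₂ none = ≤-trans
      (≤-reflexive (trans (∑-cong λ x → ⟦⟧-no (y ≟ φ x) (none x)) ∑-zero)) z≤n

  #-inject : {P : A → Set} {Q : B → Set} (P? : ∀ x → Dec (P x)) (Q? : ∀ y → Dec (Q y)) →
    (φ : A → B) → (∀ {x y} → φ x ≡ φ y → x ≡ y) → (∀ x → P x → Q (φ x)) → # P? ≤ # Q?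
  #-inject P? Q? φ inj h = ≤-trans
    (∑-mono λ x → ⟦⟧-mono (P? x) (Q? (φ x)) (h x)) (∑-inject φ inj (λ y → ⟦ Q? y ⟧))

instance
  finiteFin : ∀ {n} → Finite (Fin n)
  finiteFin {n} = record { elems = allFin n ; _≟_ = Fin._≟_ ; once = λ a →
      trans (cong sum (map-tabulate id (λ i → ⟦ i Fin.≟ a ⟧))) (diagonal a) }
    where
    zeros : ∀ n → sum (tabulate {n = n} λ _ → 0) ≡ 0
    zeros zero = refl
    zeros (suc n) = zeros n
    diagonal : ∀ {n} (a : Fin n) → sum (tabulate λ i → ⟦ i Fin.≟ a ⟧) ≡ 1
    diagonal {suc n} zero = cong suc (trans
      (cong sum (tabulate-cong λ (i : Fin n) → ⟦⟧-no (suc i Fin.≟ zero) λ ())) (zeros n))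
    diagonal (suc a) = trans
      (cong sum (tabulate-cong λ i → ⟦⟧-cong (suc i Fin.≟ suc a) (i Fin.≟ a) Fin.suc-injective (cong suc)))
      (diagonal a)

module _ {A B C : Set} (_∙_ : A → B → C) (xs : List A) (ys : List B) where

  -- Has the shape of the recursive clause of `vecs`, so the enumerations in the statement are
  -- definitionally instances of it; `tris` is another instance.
  pairs : List C
  pairs = concatMap (λ x → map (x ∙_) ys) xs

  ∑ₗ-pairs : ∀ f → ∑ₗ pairs f ≡ ∑ₗ xs (λ x → ∑ₗ ys (λ y → f (x ∙ y)))
  ∑ₗ-pairs f = trans (∑ₗ-concatMap xs (λ x → map (x ∙_) ys) f) (∑ₗ-cong xs λ x → ∑ₗ-map ys (x ∙_) f)

  pairs-once : (_≟₁_ : DecidableEquality A) (_≟₂_ : DecidableEquality B) (_≟₃_ : DecidableEquality C) →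
    (∀ {x y x′ y′} → x ∙ y ≡ x′ ∙ y′ → x ≡ x′ × y ≡ y′) →
    ∀ a b → ∑ₗ xs (λ x → ⟦ x ≟₁ a ⟧) ≡ 1 → ∑ₗ ys (λ y → ⟦ y ≟₂ b ⟧) ≡ 1 →
    ∑ₗ pairs (λ z → ⟦ z ≟₃ (a ∙ b) ⟧) ≡ 1
  pairs-once _≟₁_ _≟₂_ _≟₃_ inj a b once₁ once₂ = begin
    ∑ₗ pairs (λ z → ⟦ z ≟₃ (a ∙ b) ⟧)                           ≡⟨ ∑ₗ-pairs _ ⟩
    ∑ₗ xs (λ x → ∑ₗ ys λ y → ⟦ (x ∙ y) ≟₃ (a ∙ b) ⟧)            ≡⟨ ∑ₗ-cong xs (λ x → ∑ₗ-cong ys λ y → split x y) ⟩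
    ∑ₗ xs (λ x → ∑ₗ ys λ y → ⟦ y ≟₂ b ⟧ * ⟦ x ≟₁ a ⟧)           ≡⟨ ∑ₗ-cong xs (λ x → ∑ₗ-* ys (λ y → ⟦ y ≟₂ b ⟧) ⟦ x ≟₁ a ⟧) ⟩
    ∑ₗ xs (λ x → ∑ₗ ys (λ y → ⟦ y ≟₂ b ⟧) * ⟦ x ≟₁ a ⟧)         ≡⟨ ∑ₗ-cong xs (λ x → trans (cong (_* ⟦ x ≟₁ a ⟧) once₂) (*-identityˡ _)) ⟩
    ∑ₗ xs (λ x → ⟦ x ≟₁ a ⟧)                                    ≡⟨ once₁ ⟩
    1                                                           ∎
    where
    open ≡-Reasoning
    split : ∀ x y → ⟦ (x ∙ y) ≟₃ (a ∙ b) ⟧ ≡ ⟦ y ≟₂ b ⟧ * ⟦ x ≟₁ a ⟧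
    split x y = trans (⟦⟧-× (x ≟₁ a) (y ≟₂ b) ((x ∙ y) ≟₃ (a ∙ b)) inj (cong₂ _∙_))
      (*-comm ⟦ x ≟₁ a ⟧ _)

instance
  finiteVec : {A : Set} ⦃ _ : Finite A ⦄ → ∀ {n} → Finite (Vec A n)
  finiteVec {A} {n} = record { elems = vecs elems n ; _≟_ = Vec.≡-dec _≟_ ; once = vecs-once }
    where
    vecs-once : ∀ {n} (a : Vec A n) → ∑ₗ (vecs elems n) (λ x → ⟦ Vec.≡-dec _≟_ x a ⟧) ≡ 1
    vecs-once [] = refl
    vecs-once {suc n} (a ∷ as) = pairs-once _∷_ elems (vecs elems n) _≟_ (Vec.≡-dec _≟_) (Vec.≡-dec _≟_)
      Vec.∷-injective a as (once a) (vecs-once as)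

module _ {A : Set} ⦃ _ : Finite A ⦄ where

  opaque
    unfolding ∑

    ∑-[] : ∀ (f : Vec A 0 → ℕ) → ∑ f ≡ f []
    ∑-[] f = +-identityʳ (f [])

    ∑-∷ : ∀ {n} (f : Vec A (suc n) → ℕ) → ∑ f ≡ ∑ λ x → ∑ λ (v : Vec A n) → f (x ∷ v)
    ∑-∷ {n} = ∑ₗ-pairs _∷_ elems (vecs elems n)

  ∑-const : ∀ c → ∑ {A} (λ _ → c) ≡ card A * c
  ∑-const c = trans (∑-cong {A} λ _ → sym (*-identityˡ c)) (∑-*ʳ {A} (λ _ → 1) c)

  card-Vec : ∀ n → card (Vec A n) ≡ card A ^ n
  card-Vec zero = ∑-[] λ _ → 1
  card-Vec (suc n) = trans (∑-∷ {n} λ _ → 1) (trans (∑-const (card (Vec A n))) (cong (card A *_) (card-Vec n)))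

∑ₗ-1 : {A : Set} (xs : List A) → ∑ₗ xs (λ _ → 1) ≡ length xs
∑ₗ-1 [] = refl
∑ₗ-1 (x ∷ xs) = cong suc (∑ₗ-1 xs)

opaque
  unfolding ∑

  card-Fin : ∀ n → card (Fin n) ≡ n
  card-Fin n = trans (∑ₗ-1 (allFin n)) (length-tabulate {n = n} λ i → i)

any-∑ₗ : {A : Set} (f : A → Bool) (P : A → Set) (P? : ∀ x → Dec (P x)) →
  (∀ x → P x → f x ≡ true) → ∀ xs → ∑ₗ xs (λ x → ⟦ P? x ⟧) ≢ 0 → any f xs ≡ true
any-∑ₗ f P P? h [] ne = contradiction refl ne
any-∑ₗ f P P? h (x ∷ xs) ne with P? x
... | yes p rewrite h x p = refl
... | no _ rewrite any-∑ₗ f P P? h xs ne = ∨-zeroʳ (f x)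

any-elems : {A : Set} ⦃ _ : Finite A ⦄ (f : A → Bool) (a : A) → f a ≡ true → any f elems ≡ true
any-elems f a fa = any-∑ₗ f (_≡ a) (_≟ a) (λ { x refl → fa }) elems
  λ e → contradiction (trans (sym e) (once a)) λ ()

count+cocount : {A : Set} (f : A → Bool) (xs : List A) →
  length (filterᵇ f xs) + ∑ₗ xs (λ x → if f x then 0 else 1) ≡ length xs
count+cocount f [] = refl
count+cocount f (x ∷ xs) with f x
... | true = cong suc (count+cocount f xs)
... | false = trans (+-suc _ _) (cong suc (count+cocount f xs))

-- Upper triangular matrices, as rows of decreasing length.
data Tri (A : Set) : ℕ → Set where
  [] : Tri A 0
  _∷_ : ∀ {n} → Vec A (suc n) → Tri A n → Tri A (suc n)

∷-injectiveᵗ : ∀ {A : Set} {n} {u v : Vec A (suc n)} {U V : Tri A n} → u ∷ U ≡ v ∷ V → u ≡ v × U ≡ V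
∷-injectiveᵗ refl = refl , refl

module _ {A : Set} ⦃ _ : Finite A ⦄ where

  tris : ∀ n → List (Tri A n)
  tris zero = [] ∷ []
  tris (suc n) = pairs _∷_ elems (tris n)

  infix 4 _≟ᵗ_
  _≟ᵗ_ : ∀ {n} → DecidableEquality (Tri A n)
  [] ≟ᵗ [] = yes refl
  (u ∷ U) ≟ᵗ (v ∷ V) = map′ (λ (e , e′) → cong₂ _∷_ e e′) ∷-injectiveᵗ (u ≟ v ×-dec U ≟ᵗ V)

  instance
    finiteTri : ∀ {n} → Finite (Tri A n)
    finiteTri {n} = record { elems = tris n ; _≟_ = _≟ᵗ_ ; once = tris-once }
      where
      tris-once : ∀ {n} (U : Tri A n) → ∑ₗ (tris n) (λ V → ⟦ V ≟ᵗ U ⟧) ≡ 1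
      tris-once [] = refl
      tris-once {suc n} (u ∷ U) = pairs-once _∷_ elems (tris n) _≟_ _≟ᵗ_ _≟ᵗ_ ∷-injectiveᵗ u U (once u) (tris-once U)

  opaque
    unfolding ∑

    ∑-[]ᵗ : ∀ (f : Tri A 0 → ℕ) → ∑ f ≡ f []
    ∑-[]ᵗ f = +-identityʳ (f [])

    ∑-∷ᵗ : ∀ {n} (f : Tri A (suc n) → ℕ) → ∑ f ≡ ∑ λ (u : Vec A (suc n)) → ∑ λ (U : Tri A n) → f (u ∷ U)
    ∑-∷ᵗ {n} = ∑ₗ-pairs _∷_ elems (tris n)

  card-Tri : ∀ n → card (Tri A n) ≡ card A ^ (suc n C 2)
  card-Tri zero = ∑-[]ᵗ λ _ → 1
  card-Tri (suc n) = begin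
    card (Tri A (suc n))                          ≡⟨ ∑-∷ᵗ (λ _ → 1) ⟩
    ∑ {Vec A (suc n)} (λ _ → card (Tri A n))      ≡⟨ ∑-const {Vec A (suc n)} _ ⟩
    card (Vec A (suc n)) * card (Tri A n)         ≡⟨ cong₂ _*_ (card-Vec {A} (suc n)) (card-Tri n) ⟩
    card A ^ suc n * card A ^ (suc n C 2)         ≡⟨ ^-distribˡ-+-* (card A) (suc n) (suc n C 2) ⟨
    card A ^ (suc n + suc n C 2)                  ≡⟨ cong (card A ^_) (trans (cong (_+ suc n C 2) (sym (nC1≡n (suc n))))
                                                       (nCk+nC[k+1]≡[n+1]C[k+1] (suc n) 1)) ⟩
    card A ^ (suc (suc n) C 2)                    ∎
    where open ≡-Reasoning

-- Numerical estimates

-- This is (x - y)² = x² + y² - 2xy for x = y + e, freed of subtraction. Besides the inequality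
-- below, the exact identity is needed in the variance argument.
square-expand : ∀ y e → (y + e) * (y + e) + y * y ≡ 2 * ((y + e) * y) + e * e
square-expand = ℕ-solve-∀

2*m*n≤m²+n² : ∀ m n → 2 * (m * n) ≤ m * m + n * n
2*m*n≤m²+n² m n with ≤-total m n
... | inj₂ n≤m = subst (λ m → 2 * (m * n) ≤ m * m + n * n) (m+[n∸m]≡n n≤m)
  (subst (2 * ((n + (m ∸ n)) * n) ≤_) (sym (square-expand n (m ∸ n))) (m≤m+n _ _))
... | inj₁ m≤n = subst (λ n → 2 * (m * n) ≤ m * m + n * n) (m+[n∸m]≡n m≤n)
  (subst₂ _≤_ (cong (2 *_) (*-comm (m + (n ∸ m)) m)) (trans (sym (square-expand m (n ∸ m))) (+-comm _ (m * m))) (m≤m+n _ _))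

m²≤n²⇒m≤n : ∀ {m n} → m * m ≤ n * n → m ≤ n
m²≤n²⇒m≤n {m} {n} le with m ≤? n
... | yes m≤n = m≤n
... | no m≰n = contradiction le (<⇒≱ (*-mono-< (≰⇒> m≰n) (≰⇒> m≰n)))

[1+n]C2≤n² : ∀ n → suc n C 2 ≤ n * n
[1+n]C2≤n² zero = z≤n
[1+n]C2≤n² (suc n) = begin
  suc (suc n) C 2              ≡⟨ nCk+nC[k+1]≡[n+1]C[k+1] (suc n) 1 ⟨
  suc n C 1 + suc n C 2        ≤⟨ +-mono-≤ (≤-reflexive (nC1≡n (suc n))) ([1+n]C2≤n² n) ⟩
  suc n + n * n                ≤⟨ +-monoʳ-≤ (suc n) (*-monoʳ-≤ n (n≤1+n n)) ⟩
  suc n * suc n                ∎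
  where open ≤-Reasoning

-- (1 + 1/T)ᵐ ≤ 1/(1 − m/T), with u = T − m.
[1+T]^m*u≤T^m*T : ∀ {T} m u → m + u ≡ T → suc T ^ m * u ≤ T ^ m * T
[1+T]^m*u≤T^m*T zero u refl = ≤-refl
[1+T]^m*u≤T^m*T {T} (suc m) u e = begin
  suc T * suc T ^ m * u      ≡⟨ regroup (suc T) (suc T ^ m) u ⟩
  suc T ^ m * (u + T * u)    ≤⟨ *-monoʳ-≤ (suc T ^ m) (+-monoˡ-≤ (T * u) (≤-trans (m≤n+m u (suc m)) (≤-reflexive e))) ⟩
  suc T ^ m * (T + T * u)    ≡⟨ regroup′ (suc T ^ m) T u ⟩
  T * (suc T ^ m * suc u)    ≤⟨ *-monoʳ-≤ T ([1+T]^m*u≤T^m*T m (suc u) (trans (+-suc m u) e)) ⟩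
  T * (T ^ m * T)            ≡⟨ *-assoc T (T ^ m) T ⟨
  T ^ suc m * T              ∎
  where
  open ≤-Reasoning
  regroup : ∀ a b u → a * b * u ≡ b * (a * u)
  regroup = ℕ-solve-∀
  regroup′ : ∀ a T u → a * (T + T * u) ≡ T * (a * suc u)
  regroup′ = ℕ-solve-∀

-- From m ≤ n² follows T - m ≥ s n², so (1 + 1/T)^m ≤ T / (T - m) ≤ (s + 1) / s. This fixes the
-- choice of T.
growth-bound : ∀ s n m .{{_ : NonZero n}} → m ≤ n * n → let T = suc s * (n * n) in suc T ^ m * s ≤ T ^ m * suc s
growth-bound s n m m≤n² = *-cancelʳ-≤ _ _ (n * n) ⦃ m*n≢0 n n ⦄ (begin
  suc T ^ m * s * (n * n)      ≡⟨ *-assoc (suc T ^ m) s (n * n) ⟩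
  suc T ^ m * (s * (n * n))    ≤⟨ *-monoʳ-≤ (suc T ^ m) (m+n≤o⇒m≤o∸n (s * (n * n)) (≤-trans (≤-reflexive (+-comm _ m)) (+-monoˡ-≤ _ m≤n²))) ⟩
  suc T ^ m * (T ∸ m)          ≤⟨ [1+T]^m*u≤T^m*T m (T ∸ m) (m+[n∸m]≡n (≤-trans m≤n² (m≤m+n (n * n) _))) ⟩
  T ^ m * (suc s * (n * n))    ≡⟨ *-assoc (T ^ m) (suc s) (n * n) ⟨
  T ^ m * suc s * (n * n)      ∎)
  where
  open ≤-Reasoning
  T : ℕ
  T = suc s * (n * n)

-- Stands in for the logarithm to base q, rounded up. When x grows by one, j can stay unless q^j
-- equals the old x; then one further factor q restores both bounds.
power-between : ∀ {q} → 1 < q → ∀ x → 0 < x → ∃ λ j → x ≤ q ^ j × q ^ j ≤ q * x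
power-between {q} 1<q (suc zero) _ = 0 , ≤-refl , ≤-trans (<⇒≤ 1<q) (≤-reflexive (sym (*-identityʳ q)))
power-between {q} 1<q (suc (suc x)) _ with power-between 1<q (suc x) (s≤s z≤n)
... | j , lower , upper with suc (suc x) ≤? q ^ j
... | yes le = j , le , ≤-trans upper (*-monoʳ-≤ q (n≤1+n (suc x)))
... | no nle = suc j , ≤-trans (m<q*m (suc x)) (*-monoʳ-≤ q lower) , *-monoʳ-≤ q (<⇒≤ (≰⇒> nle))
  where
  m<q*m : ∀ m .{{_ : NonZero m}} → m < q * m
  m<q*m m = subst (m <_) (*-comm m q) (m<m*n m q 1<q)

-- Here `X` counts forms, `Tot` tuples, `B` bad tuples and `W` degenerate forms; `L` is the moment
-- sum, and `Tm`, `T₁m`, `qm` are the m-th powers of T, T + 1 and q. In units of `X * Tot`, the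
-- generic forms exceed 1 by at most 1/s and the degenerate ones add at most 1/s, so `B` is at most
-- 2/s = 1/(k+1) of `Tot`.
combine-bounds : ∀ k X Tot B L Tm T₁m W qm .{{_ : NonZero X}} .{{_ : NonZero Tm}} → let s = 2 * suc k in
  X * (Tot + B) ≤ L →
  L * Tm ≤ X * (Tot * T₁m) + W * (qm * Tot * Tm) →
  T₁m * s ≤ Tm * suc s →
  s * W * qm ≤ X →
  suc k * B ≤ Tot
combine-bounds k X Tot B L Tm T₁m W qm lower upper growth few =
  *-cancelˡ-≤ 2 (+-cancelˡ-≤ (s * Tot) _ _ (*-cancelˡ-≤ X (*-cancelʳ-≤ _ _ Tm (begin
    X * (s * Tot + 2 * (suc k * B)) * Tm                          ≡⟨ regroup₁ X (suc k) Tot B Tm ⟩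
    s * (X * (Tot + B)) * Tm                                      ≤⟨ *-monoˡ-≤ Tm (*-monoʳ-≤ s lower) ⟩
    s * L * Tm                                                    ≡⟨ *-assoc s L Tm ⟩
    s * (L * Tm)                                                  ≤⟨ *-monoʳ-≤ s upper ⟩
    s * (X * (Tot * T₁m) + W * (qm * Tot * Tm))                   ≡⟨ regroup₂ s X Tot T₁m W qm Tm ⟩
    X * Tot * (T₁m * s) + s * W * qm * (Tot * Tm)                 ≤⟨ +-mono-≤ (*-monoʳ-≤ (X * Tot) growth) (*-monoˡ-≤ (Tot * Tm) few) ⟩
    X * Tot * (Tm * suc s) + X * (Tot * Tm)                       ≡⟨ regroup₃ X Tot Tm s ⟩
    X * (s * Tot + 2 * Tot) * Tm                                  ∎))))
  where
  open ≤-Reasoning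
  s : ℕ
  s = 2 * suc k
  regroup₁ : ∀ X c Tot B Tm → X * (2 * c * Tot + 2 * (c * B)) * Tm ≡ 2 * c * (X * (Tot + B)) * Tm
  regroup₁ = ℕ-solve-∀
  regroup₂ : ∀ s X Tot T₁m W qm Tm → s * (X * (Tot * T₁m) + W * (qm * Tot * Tm)) ≡ X * Tot * (T₁m * s) + s * W * qm * (Tot * Tm)
  regroup₂ = ℕ-solve-∀
  regroup₃ : ∀ X Tot Tm s → X * Tot * (Tm * (1 + s)) + X * (Tot * Tm) ≡ X * (s * Tot + 2 * Tot) * Tm
  regroup₃ = ℕ-solve-∀

^-distribʳ-* : ∀ k m n → (m * n) ^ k ≡ m ^ k * n ^ k
^-distribʳ-* zero m n = refl
^-distribʳ-* (suc k) m n = trans (cong (m * n *_) (^-distribʳ-* k m n)) ([m*n]*[o*p]≡[m*o]*[n*p] m n _ _)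

-- The factor free of n in s · 2 · (q⁴ T²)², where T = (s + 1) n²; the remaining factor is n⁸.
threshold : ℕ → ℕ → ℕ
threshold q s = let c = suc s in 2 * (q * q * q * q * q * q * q * q) * (c * c * c * c) * s

-- With R = q^j the product is s times the n-th power of 2 R², and s ≤ s^n lets the constant join
-- the base. As R ≤ q⁴ T² is of order n⁴, the base is at most a constant times n⁸, and one more
-- factor n absorbs the constant.
degenerate-negligible : ∀ q s n j .{{_ : NonZero s}} → threshold q s ≤ n → 0 < n →
  let T = suc s * (n * n) in q ^ j ≤ q * (q * q * q * (T * T)) →
  s * (2 ^ n * (q ^ j) ^ n * (q ^ n) ^ j) ≤ n ^ (11 * n)
degenerate-negligible q s n j big 0<n qʲ≤ = begin
  s * (2 ^ n * R ^ n * (q ^ n) ^ j)          ≡⟨ cong (λ z → s * (2 ^ n * R ^ n * z)) (trans (^-*-assoc q n j)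
                                                  (trans (cong (q ^_) (*-comm n j)) (sym (^-*-assoc q j n)))) ⟩
  s * (2 ^ n * R ^ n * R ^ n)                ≤⟨ *-monoˡ-≤ _ s≤sⁿ ⟩
  s ^ n * (2 ^ n * R ^ n * R ^ n)            ≡⟨ cong (s ^ n *_) (trans (cong (_* R ^ n) (sym (^-distribʳ-* n 2 R))) (sym (^-distribʳ-* n (2 * R) R))) ⟩
  s ^ n * (2 * R * R) ^ n                    ≡⟨ ^-distribʳ-* n s (2 * R * R) ⟨
  (s * (2 * R * R)) ^ n                      ≤⟨ ^-monoˡ-≤ n base ⟩
  (n ^ 11) ^ n                               ≡⟨ ^-*-assoc n 11 n ⟩
  n ^ (11 * n)                               ∎
  where
  open ≤-Reasoning
  R Y : ℕ
  R = q ^ j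
  Y = q * (q * q * q * ((suc s * (n * n)) * (suc s * (n * n))))
  s≤sⁿ : s ≤ s ^ n
  s≤sⁿ = ≤-trans (≤-reflexive (sym (*-identityʳ s))) (^-monoʳ-≤ s {1} {n} 0<n)
  regroup : ∀ q c n s → s * (2 * (q * (q * q * q * ((c * (n * n)) * (c * (n * n))))) * (q * (q * q * q * ((c * (n * n)) * (c * (n * n)))))) ≡
    2 * (q * q * q * q * q * q * q * q) * (c * c * c * c) * s * (n * (n * (n * (n * (n * (n * (n * (n * 1))))))))
  regroup = ℕ-solve-∀
  base : s * (2 * R * R) ≤ n ^ 11
  base = begin
    s * (2 * R * R)              ≤⟨ *-monoʳ-≤ s (*-mono-≤ (*-monoʳ-≤ 2 qʲ≤) qʲ≤) ⟩
    s * (2 * Y * Y)              ≡⟨ regroup q (suc s) n s ⟩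
    threshold q s * n ^ 8        ≤⟨ *-monoˡ-≤ (n ^ 8) big ⟩
    n ^ 9                        ≤⟨ ^-monoʳ-≤ n ⦃ >-nonZero 0<n ⦄ (m≤m+n 9 2) ⟩
    n ^ 11                       ∎

-- Linear algebra and quadratic forms over a finite field

module FiniteField
  (F : Set) (_+F_ _*F_ : F → F → F) (-F_ : F → F) (0F 1F : F)
  (isCommutativeRing : IsCommutativeRing _≡_ _+F_ _*F_ -F_ 0F 1F)
  ⦃ _ : Finite F ⦄
  (inverse : ∀ {b} → b ≢ 0F → ∃ λ t → t *F b ≡ 1F)
  (0≢1 : 0F ≢ 1F)
  where

  commutativeRing : CommutativeRing _ _
  commutativeRing = record { isCommutativeRing = isCommutativeRing }

  open CommutativeRing commutativeRing using ()
    renaming (_+_ to infixl 6 _⊕_; _*_ to infixl 7 _⊗_; -_ to infix 8 ⊖_; 0# to 𝟘; 1# to 𝟙)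
  open CommutativeRing commutativeRing using ()
    renaming (zeroˡ to ⊗-zeroˡ; zeroʳ to ⊗-zeroʳ; *-identityˡ to ⊗-identityˡ; *-identityʳ to ⊗-identityʳ;
      *-assoc to ⊗-assoc; *-comm to ⊗-comm; +-identityˡ to ⊕-identityˡ; +-identityʳ to ⊕-identityʳ;
      +-assoc to ⊕-assoc; +-comm to ⊕-comm; -‿inverseʳ to ⊖-inverseʳ; -‿inverseˡ to ⊖-inverseˡ)
  open AbelianGroupProperties (CommutativeRing.+-abelianGroup commutativeRing) using ()
    renaming (∙-cancelʳ to ⊕-cancelʳ; ∙-cancelˡ to ⊕-cancelˡ)
  open NaturalCoefficients (CommutativeRing.commutativeSemiring commutativeRing) using (solve; _:=_; _:+_; _:*_; con)

  q : ℕ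
  q = card F

  1<q : 1 < q
  1<q = begin
    2                                             ≡⟨ cong₂ _+_ (∑-once 𝟘) (∑-once 𝟙) ⟨
    # {A = F} (_≟ 𝟘) + # {A = F} (_≟ 𝟙)           ≡⟨ ∑-+ {F} (λ x → ⟦ x ≟ 𝟘 ⟧) (λ x → ⟦ x ≟ 𝟙 ⟧) ⟨
    ∑ (λ x → ⟦ x ≟ 𝟘 ⟧ + ⟦ x ≟ 𝟙 ⟧)               ≤⟨ ∑-mono one ⟩
    q                                             ∎
    where
    open ≤-Reasoning
    one : ∀ x → ⟦ x ≟ 𝟘 ⟧ + ⟦ x ≟ 𝟙 ⟧ ≤ 1
    one x with x ≟ 𝟘
    ... | no _ = ⟦⟧≤1 (x ≟ 𝟙)
    ... | yes refl = ≤-reflexive (cong suc (⟦⟧-no (x ≟ 𝟙) 0≢1))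

  instance
    q≢0 : NonZero q
    q≢0 = >-nonZero (<-trans (s≤s z≤n) 1<q)

  -- Vectors and the dot product.

  infix 7 _·_
  _·_ : ∀ {n} → Vec F n → Vec F n → F
  [] · [] = 𝟘
  (x ∷ v) · (y ∷ w) = x ⊗ y ⊕ v · w

  infixl 6 _+[_]_
  -- One operation covers sums (t = 𝟙), differences (t = ⊖ 𝟙) and motion along a line, so linearity
  -- and cancellation are proved only once.
  _+[_]_ : ∀ {n} → Vec F n → F → Vec F n → Vec F n
  u +[ t ] w = zipWith (λ a b → a ⊕ t ⊗ b) u w

  0ᵛ : ∀ {n} → Vec F n
  0ᵛ = replicate _ 𝟘

  ·-comm : ∀ {n} (v w : Vec F n) → v · w ≡ w · v
  ·-comm [] [] = refl
  ·-comm (x ∷ v) (y ∷ w) = cong₂ _⊕_ (⊗-comm x y) (·-comm v w)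

  ·-+[] : ∀ {n} (v u : Vec F n) t w → v · (u +[ t ] w) ≡ v · u ⊕ t ⊗ (v · w)
  ·-+[] [] [] t [] = sym (trans (cong (𝟘 ⊕_) (⊗-zeroʳ t)) (⊕-identityʳ 𝟘))
  ·-+[] (x ∷ v) (y ∷ u) t (z ∷ w) =
    trans (cong (x ⊗ (y ⊕ t ⊗ z) ⊕_) (·-+[] v u t w)) (rearrange x y t z (v · u) (v · w))
    where
    rearrange : ∀ x y t z a b → x ⊗ (y ⊕ t ⊗ z) ⊕ (a ⊕ t ⊗ b) ≡ x ⊗ y ⊕ a ⊕ t ⊗ (x ⊗ z ⊕ b)
    rearrange = solve 6 (λ x y t z a b →
      x :* (y :+ t :* z) :+ (a :+ t :* b) := x :* y :+ a :+ t :* (x :* z :+ b)) refl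

  +[]-cancel : ∀ {n} t (w : Vec F n) {u u′} → u +[ t ] w ≡ u′ +[ t ] w → u ≡ u′
  +[]-cancel t [] {[]} {[]} _ = refl
  +[]-cancel t (z ∷ w) {y ∷ u} {y′ ∷ u′} e =
    cong₂ _∷_ (⊕-cancelʳ (t ⊗ z) y y′ (Vec.∷-injectiveˡ e)) (+[]-cancel t w (Vec.∷-injectiveʳ e))

  0+[]0 : ∀ {n} t → 0ᵛ {n} +[ t ] 0ᵛ ≡ 0ᵛ
  0+[]0 {zero} t = refl
  0+[]0 {suc n} t = cong₂ _∷_ (trans (cong (𝟘 ⊕_) (⊗-zeroʳ t)) (⊕-identityʳ 𝟘)) (0+[]0 t)

  0·≡0 : ∀ {n} (x : Vec F n) → 0ᵛ · x ≡ 𝟘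
  0·≡0 [] = refl
  0·≡0 (x ∷ v) = trans (cong₂ _⊕_ (⊗-zeroˡ x) (0·≡0 v)) (⊕-identityʳ 𝟘)

  ·0≡0 : ∀ {n} (x : Vec F n) → x · 0ᵛ ≡ 𝟘
  ·0≡0 x = trans (·-comm x 0ᵛ) (0·≡0 x)

  nondegenerate : ∀ {n} (v : Vec F n) → v ≢ 0ᵛ → ∃ λ h → v · h ≢ 𝟘
  nondegenerate [] v≢0 = contradiction refl v≢0
  nondegenerate (x ∷ v) v≢0 with x ≟ 𝟘
  ... | no x≢0 = (𝟙 ∷ 0ᵛ) , λ e → x≢0 (trans (sym (trans (cong₂ _⊕_ (⊗-identityʳ x) (·0≡0 v)) (⊕-identityʳ x))) e)
  ... | yes refl with nondegenerate v (λ e → v≢0 (cong (𝟘 ∷_) e))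
  ... | h , vh≢0 = (𝟘 ∷ h) , λ e → vh≢0 (trans (sym (trans (cong (_⊕ v · h) (⊗-zeroˡ 𝟘)) (⊕-identityˡ _))) e)

  -- Kernels, and the number of matrices of low rank.

  mv : ∀ {i n} → Vec (Vec F n) i → Vec F n → Vec F i
  mv R h = Vec.map (_· h) R

  mv-+[] : ∀ {i n} (R : Vec (Vec F n) i) u t w → mv R (u +[ t ] w) ≡ mv R u +[ t ] mv R w
  mv-+[] [] u t w = refl
  mv-+[] (v ∷ R) u t w = cong₂ _∷_ (·-+[] v u t w) (mv-+[] R u t w)

  inKer? : ∀ {i n} (R : Vec (Vec F n) i) h → Dec (mv R h ≡ 0ᵛ)
  inKer? R h = mv R h ≟ 0ᵛ

  -- The number of kernel vectors, hence q to the power of the usual nullity; the quotient of q^n by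
  -- it is q^rank.
  nullity : ∀ {i n} → Vec (Vec F n) i → ℕ
  nullity R = # (inKer? R)

  nullity-[] : ∀ {n} → nullity {n = n} [] ≡ q ^ n
  nullity-[] {n} = trans (∑-cong λ (h : Vec F n) → ⟦⟧-yes (inKer? [] h) refl) (card-Vec n)

  nullity≤ : ∀ {i n} (R : Vec (Vec F n) i) → nullity R ≤ q ^ n
  nullity≤ {n = n} R = ≤-trans (∑-mono λ h → ⟦⟧≤1 (inKer? R h)) (≤-reflexive (card-Vec n))

  module _ {i n : ℕ} (R : Vec (Vec F n) i) (v : Vec F n) where

    slice? : ∀ a h → Dec (mv R h ≡ 0ᵛ × v · h ≡ a)
    slice? a h = inKer? R h ×-dec (v · h ≟ a)

    ∑-slice : ∑ (λ a → # (slice? a)) ≡ nullity R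
    ∑-slice = begin
      ∑ (λ a → # (slice? a))                                        ≡⟨ ∑-comm {F} {Vec F n} _ ⟩
      ∑ (λ h → ∑ λ a → ⟦ slice? a h ⟧)                              ≡⟨ ∑-cong (λ h → ∑-cong λ a →
          ⟦⟧-× (a ≟ v · h) (inKer? R h) (slice? a h) (λ (k , e) → sym e , k) (λ e k → k , sym e)) ⟩
      ∑ (λ h → ∑ λ a → ⟦ a ≟ v · h ⟧ * ⟦ inKer? R h ⟧)              ≡⟨ ∑-cong (λ h → ∑-δ (λ _ → ⟦ inKer? R h ⟧) (v · h)) ⟩
      nullity R                                                     ∎
      where open ≡-Reasoning

    module _ (h₁ : Vec F n) (ker : mv R h₁ ≡ 0ᵛ) (vh₁≢0 : v · h₁ ≢ 𝟘) where

      -- Translation by (a′ - a) / (v · h₁) times the kernel vector h₁ stays inside the kernel and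
      -- moves the value of v from a to a′.
      slice≤slice : ∀ a a′ → # (slice? a) ≤ # (slice? a′)
      slice≤slice a a′ with inverse vh₁≢0
      ... | s , sb≡1 = #-inject (slice? a) (slice? a′) (_+[ t ] h₁) (+[]-cancel t h₁) λ h (k , e) →
          trans (mv-+[] R h t h₁) (trans (cong₂ _+[ t ]_ k ker) (0+[]0 t)) ,
          trans (·-+[] v h t h₁) (trans (cong (_⊕ t ⊗ (v · h₁)) e) move)
        where
        t : F
        t = (a′ ⊕ ⊖ a) ⊗ s
        move : a ⊕ t ⊗ (v · h₁) ≡ a′
        move = begin
          a ⊕ (a′ ⊕ ⊖ a) ⊗ s ⊗ (v · h₁)   ≡⟨ cong (a ⊕_) (⊗-assoc (a′ ⊕ ⊖ a) s (v · h₁)) ⟩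
          a ⊕ (a′ ⊕ ⊖ a) ⊗ (s ⊗ (v · h₁)) ≡⟨ cong (λ x → a ⊕ (a′ ⊕ ⊖ a) ⊗ x) sb≡1 ⟩
          a ⊕ (a′ ⊕ ⊖ a) ⊗ 𝟙              ≡⟨ cong (a ⊕_) (trans (⊗-identityʳ _) (⊕-comm a′ (⊖ a))) ⟩
          a ⊕ (⊖ a ⊕ a′)                  ≡⟨ ⊕-assoc a (⊖ a) a′ ⟨
          a ⊕ ⊖ a ⊕ a′                    ≡⟨ cong (_⊕ a′) (⊖-inverseʳ a) ⟩
          𝟘 ⊕ a′                          ≡⟨ ⊕-identityˡ a′ ⟩
          a′                              ∎
          where open ≡-Reasoning

      q*slice : ∀ a → q * # (slice? a) ≡ nullity R
      q*slice a = trans (sym (∑-const {F} (# (slice? a))))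
        (trans (∑-cong λ a′ → ≤-antisym (slice≤slice a a′) (slice≤slice a′ a)) ∑-slice)

    nullity-∷ : nullity (v ∷ R) ≡ # (slice? 𝟘)
    nullity-∷ = ∑-cong λ h → ⟦⟧-cong (inKer? (v ∷ R) h) (slice? 𝟘 h)
      (λ e → Vec.∷-injectiveʳ e , Vec.∷-injectiveˡ e) (λ (k , e) → cong₂ _∷_ e k)

    -- Either v vanishes on the whole kernel of R, or its values cut that kernel into q slices of
    -- equal size, of which only the zero slice survives.
    nullity-dichotomy : nullity (v ∷ R) ≡ nullity R ⊎ q * nullity (v ∷ R) ≡ nullity R
    nullity-dichotomy with search (λ h → inKer? R h ×-dec ¬? (v · h ≟ 𝟘))
    ... | inj₁ (h₁ , ker , vh₁≢0) = inj₂ (trans (cong (q *_) nullity-∷) (q*slice h₁ ker vh₁≢0 𝟘))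
    ... | inj₂ none = inj₁ (trans nullity-∷ (∑-cong λ h → ⟦⟧-cong (slice? 𝟘 h) (inKer? R h) proj₁
            (λ k → k , zero′ h k)))
      where
      zero′ : ∀ h → mv R h ≡ 0ᵛ → v · h ≡ 𝟘
      zero′ h k with v · h ≟ 𝟘
      ... | yes e = e
      ... | no ne = contradiction (k , ne) (none h)

  hyperplane : ∀ {n} (v : Vec F n) → v ≢ 0ᵛ → ∀ a → q * # (λ x → v · x ≟ a) ≡ q ^ n
  hyperplane {n} v v≢0 a with nondegenerate v v≢0
  ... | h , vh≢0 = trans (cong (q *_) (∑-cong λ x → ⟦⟧-cong (v · x ≟ a) (slice? [] v a x) (refl ,_) proj₂))
    (trans (q*slice [] v h refl vh≢0 a) (nullity-[] {n}))

  0<qⁿ : ∀ n → 0 < q ^ n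
  0<qⁿ n = m^n>0 q n

  -- Double counting of the pairs (v, h) with h in the kernel of R and v · h = 0.
  flat-rows : ∀ {i n} (R : Vec (Vec F n) i) →
    # (λ v → nullity (v ∷ R) ℕ≟ nullity R) * nullity R ≤ q ^ n
  flat-rows {n = n} R = *-cancelˡ-≤ r ⦃ >-nonZero (m<n⇒0<n∸m 1<q) ⦄
      (+-cancelˡ-≤ (P * κ) _ _ (begin
    P * κ + r * (# flat? * κ)                                  ≡⟨ cong₂ _+_ (cong (_* κ) (sym (card-Vec n))) (pull r (# flat?) κ) ⟩
    card (Vec F n) * κ + # flat? * (r * κ)                     ≡⟨ cong₂ _+_ (∑-const {Vec F n} κ) (∑-*ʳ (λ v → ⟦ flat? v ⟧) (r * κ)) ⟨
    ∑ {Vec F n} (λ _ → κ) + ∑ (λ v → ⟦ flat? v ⟧ * (r * κ))    ≡⟨ ∑-+ {Vec F n} _ _ ⟨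
    ∑ (λ v → κ + ⟦ flat? v ⟧ * (r * κ))                        ≤⟨ ∑-mono row ⟩
    ∑ (λ v → q * nullity (v ∷ R))                              ≡⟨ ∑-*ˡ {Vec F n} q _ ⟩
    q * ∑ (λ v → nullity (v ∷ R))                              ≡⟨ cong (q *_) (∑-cong λ v → ∑-cong λ h → split v h) ⟩
    q * ∑ (λ v → ∑ λ h → ⟦ v · h ≟ 𝟘 ⟧ * ⟦ inKer? R h ⟧)       ≡⟨ cong (q *_) (∑-comm {Vec F n} {Vec F n} _) ⟩
    q * ∑ (λ h → ∑ λ v → ⟦ v · h ≟ 𝟘 ⟧ * ⟦ inKer? R h ⟧)       ≡⟨ cong (q *_) (∑-cong λ h → ∑-*ʳ (λ v → ⟦ v · h ≟ 𝟘 ⟧) ⟦ inKer? R h ⟧) ⟩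
    q * ∑ (λ h → perp h * ⟦ inKer? R h ⟧)                      ≡⟨ ∑-*ˡ {Vec F n} q _ ⟨
    ∑ (λ h → q * (perp h * ⟦ inKer? R h ⟧))                    ≤⟨ ∑-mono column ⟩
    ∑ (λ h → P * ⟦ inKer? R h ⟧ + ⟦ h ≟ 0ᵛ ⟧ * (r * P))        ≡⟨ ∑-+ {Vec F n} _ _ ⟩
    ∑ (λ h → P * ⟦ inKer? R h ⟧) + ∑ (λ h → ⟦ h ≟ 0ᵛ ⟧ * (r * P))
                                                               ≡⟨ cong₂ _+_ (∑-*ˡ {Vec F n} P _) (∑-δ {Vec F n} (λ _ → r * P) 0ᵛ) ⟩
    P * κ + r * P                                              ∎))
    where
    open ≤-Reasoning
    P κ r : ℕ
    P = q ^ n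
    κ = nullity R
    r = q ∸ 1
    1+r≡q : suc r ≡ q
    1+r≡q = m+[n∸m]≡n (<⇒≤ 1<q)
    flat? : ∀ v → Dec (nullity (v ∷ R) ≡ κ)
    flat? v = nullity (v ∷ R) ℕ≟ κ
    perp : Vec F n → ℕ
    perp h = # λ v → v · h ≟ 𝟘
    pull : ∀ a b c → a * (b * c) ≡ b * (a * c)
    pull = ℕ-solve-∀
    -- After multiplication by q, a row that cuts the kernel counts κ and a flat one q κ, so each
    -- flat row shows up as an excess of (q - 1) κ.
    row : ∀ v → κ + ⟦ flat? v ⟧ * (r * κ) ≤ q * nullity (v ∷ R)
    row v with flat? v
    ... | yes e = ≤-reflexive (trans (cong (κ +_) (+-identityʳ _)) (trans (cong (_* κ) 1+r≡q) (cong (q *_) (sym e))))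
    ... | no ne with nullity-dichotomy R v
    ... | inj₁ e = contradiction e ne
    ... | inj₂ e = ≤-reflexive (trans (+-identityʳ κ) (sym e))
    split : ∀ v h → ⟦ inKer? (v ∷ R) h ⟧ ≡ ⟦ v · h ≟ 𝟘 ⟧ * ⟦ inKer? R h ⟧
    split v h = ⟦⟧-× (v · h ≟ 𝟘) (inKer? R h) (inKer? (v ∷ R) h) Vec.∷-injective (cong₂ _∷_)
    -- In the same units a nonzero kernel vector counts P, being orthogonal to a hyperplane of rows;
    -- only h = 0 exceeds this, by (q - 1) P.
    column : ∀ h → q * (perp h * ⟦ inKer? R h ⟧) ≤ P * ⟦ inKer? R h ⟧ + ⟦ h ≟ 0ᵛ ⟧ * (r * P)
    column h with inKer? R h
    ... | no _ = ≤-trans (≤-reflexive (trans (cong (q *_) (*-zeroʳ (perp h))) (*-zeroʳ q))) z≤n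
    ... | yes _ with h ≟ 0ᵛ
    ... | no h≢0 = ≤-trans (≤-reflexive (trans (cong (q *_) (*-identityʳ (perp h)))
            (trans (cong (q *_) (∑-cong λ v → cong (λ x → ⟦ x ≟ 𝟘 ⟧) (·-comm v h))) (hyperplane h h≢0 𝟘))))
            (≤-reflexive (sym (trans (+-identityʳ _) (*-identityʳ P))))
    ... | yes _ = ≤-trans (*-monoʳ-≤ q (≤-trans (≤-reflexive (*-identityʳ (perp h)))
            (≤-trans (∑-mono λ v → ⟦⟧≤1 (v · h ≟ 𝟘)) (≤-reflexive (card-Vec n)))))
            (≤-reflexive (trans (cong (_* P) (sym 1+r≡q)) (sym (cong₂ _+_ (*-identityʳ P) (+-identityʳ _)))))

  -- Means rank A < j, since q^n / `nullity A` is q^rank. The strict form leaves nothing at j = 0,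
  -- which is a base case of the count below.
  low-rank? : ∀ {i n} j (A : Vec (Vec F n) i) → Dec (q * q ^ n ≤ nullity A * q ^ j)
  low-rank? {n = n} j A = q * q ^ n ≤? nullity A * q ^ j

  -- Appending a row to A either leaves the kernel unchanged, and then the row is one of the
  -- few that annihilate it, or divides the nullity by q, which can happen fewer than j times.
  low-rank-count : ∀ i n j → # (low-rank? {i} {n} j) ≤ 2 ^ i * (q ^ j) ^ i * (q ^ n) ^ j
  low-rank-count i n zero = ≤-trans
    (≤-reflexive (trans (∑-cong λ A → ⟦⟧-no (low-rank? 0 A) (impossible A)) (∑-zero {Vec (Vec F n) i}))) z≤n
    where
    impossible : ∀ A → ¬ (q * q ^ n ≤ nullity A * 1)
    impossible A le = <⇒≱ (m<m*n (q ^ n) q ⦃ >-nonZero (0<qⁿ n) ⦄ 1<q)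
      (≤-trans (≤-reflexive (*-comm (q ^ n) q)) (≤-trans le (≤-trans (≤-reflexive (*-identityʳ (nullity A))) (nullity≤ A))))
  low-rank-count zero n (suc j) = ≤-trans (≤-reflexive (∑-[] {A = Vec F n} λ A → ⟦ low-rank? (suc j) A ⟧))
    (≤-trans (⟦⟧≤1 (low-rank? {n = n} (suc j) [])) (≤-trans (0<qⁿⁿ (suc j)) (≤-reflexive (sym (*-identityˡ _)))))
    where
    0<qⁿⁿ : ∀ j → 0 < (q ^ n) ^ j
    0<qⁿⁿ j = m^n>0 (q ^ n) ⦃ >-nonZero (0<qⁿ n) ⦄ j
  low-rank-count (suc i) n (suc j) = begin
    # (low-rank? {suc i} {n} (suc j))                                        ≡⟨ ∑-∷ {Vec F n} {i} _ ⟩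
    (∑ λ v → ∑ λ A → ⟦ low-rank? {suc i} (suc j) (v ∷ A) ⟧)                  ≡⟨ ∑-comm {Vec F n} {Vec (Vec F n) i} _ ⟩
    (∑ λ A → ∑ λ v → ⟦ low-rank? {suc i} (suc j) (v ∷ A) ⟧)                  ≤⟨ ∑-mono {Vec (Vec F n) i} rows ⟩
    (∑ λ A → ⟦ low-rank? {i} (suc j) A ⟧ * q ^ j + ⟦ low-rank? {i} j A ⟧ * P)   ≡⟨ ∑-+ {Vec (Vec F n) i} _ _ ⟩
    (∑ λ A → ⟦ low-rank? {i} (suc j) A ⟧ * q ^ j) + (∑ λ A → ⟦ low-rank? {i} j A ⟧ * P)
                                        ≡⟨ cong₂ _+_ (∑-*ʳ {Vec (Vec F n) i} _ (q ^ j)) (∑-*ʳ {Vec (Vec F n) i} _ P) ⟩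
    # (low-rank? {i} {n} (suc j)) * q ^ j + # (low-rank? {i} {n} j) * P
                                        ≤⟨ +-mono-≤ (*-mono-≤ (low-rank-count i n (suc j)) qʲ≤) (*-monoˡ-≤ P (low-rank-count i n j)) ⟩
    -- Enlarging the second summand makes it equal to the first. Each row thus doubles the bound,
    -- once for leaving and once for raising the rank, and this is the source of the factor 2^i.
    2 ^ i * Q ^ i * (P * P ^ j) * Q + 2 ^ i * (q ^ j) ^ i * P ^ j * P
                                        ≤⟨ +-monoʳ-≤ _ (*-monoˡ-≤ P (*-monoˡ-≤ (P ^ j) (*-monoʳ-≤ (2 ^ i) (≤-trans (^-monoˡ-≤ i qʲ≤)
                                             (≤-trans (≤-reflexive (sym (*-identityʳ _))) (*-monoʳ-≤ (Q ^ i) (0<qⁿ (suc j)))))))) ⟩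
    2 ^ i * Q ^ i * (P * P ^ j) * Q + 2 ^ i * (Q ^ i * Q) * P ^ j * P   ≡⟨ collect (2 ^ i) Q (Q ^ i) P (P ^ j) ⟩
    2 ^ suc i * Q ^ suc i * P ^ suc j   ∎
    where
    open ≤-Reasoning
    P Q : ℕ
    P = q ^ n
    Q = q ^ suc j
    qʲ≤ : q ^ j ≤ Q
    qʲ≤ = ^-monoʳ-≤ q (n≤1+n j)
    collect : ∀ t Q Qi P Pj → t * Qi * (P * Pj) * Q + t * (Qi * Q) * Pj * P ≡ 2 * t * (Q * Qi) * (P * Pj)
    collect = ℕ-solve-∀
    instance
      P≢0 : NonZero P
      P≢0 = >-nonZero (0<qⁿ n)
    module _ (A : Vec (Vec F n) i) where
      κ : ℕ
      κ = nullity A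
      flat? : ∀ v → Dec (nullity (v ∷ A) ≡ κ)
      flat? v = nullity (v ∷ A) ℕ≟ κ
      row : ∀ v → ⟦ low-rank? {suc i} (suc j) (v ∷ A) ⟧ ≤ ⟦ flat? v ⟧ * ⟦ low-rank? (suc j) A ⟧ + ⟦ low-rank? j A ⟧
      row v with flat? v
      ... | yes e = ≤-trans (⟦⟧-mono (low-rank? {suc i} (suc j) (v ∷ A)) (low-rank? (suc j) A)
                (subst (λ k → q * P ≤ k * Q) e))
              (≤-trans (≤-reflexive (sym (+-identityʳ _))) (m≤m+n _ _))
      ... | no ne with nullity-dichotomy A v
      ... | inj₁ e = contradiction e ne
      ... | inj₂ e = ⟦⟧-mono (low-rank? {suc i} (suc j) (v ∷ A)) (low-rank? j A) λ le →
              ≤-trans le (≤-reflexive (trans (assoc q (nullity (v ∷ A)) (q ^ j)) (cong (_* q ^ j) e)))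
        where
        assoc : ∀ q k x → k * (q * x) ≡ q * k * x
        assoc = ℕ-solve-∀
      -- `flat-rows` leaves at most P / κ rows that keep the kernel, and low rank of A says that
      -- this quotient is at most q^j.
      few-flat : # flat? * ⟦ low-rank? (suc j) A ⟧ ≤ ⟦ low-rank? (suc j) A ⟧ * q ^ j
      few-flat with low-rank? (suc j) A
      ... | no _ = ≤-reflexive (*-zeroʳ (# flat?))
      ... | yes le = subst₂ _≤_ (sym (*-identityʳ (# flat?))) (sym (+-identityʳ (q ^ j)))
              (*-cancelʳ-≤ (# flat?) (q ^ j) P (begin
                # flat? * P              ≤⟨ *-monoʳ-≤ (# flat?) P≤κqʲ ⟩
                # flat? * (κ * q ^ j)    ≡⟨ *-assoc (# flat?) κ (q ^ j) ⟨
                # flat? * κ * q ^ j      ≤⟨ *-monoˡ-≤ (q ^ j) (flat-rows A) ⟩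
                P * q ^ j                ≡⟨ *-comm P (q ^ j) ⟩
                q ^ j * P                ∎))
        where
        assoc : ∀ q k x → k * (q * x) ≡ q * (k * x)
        assoc = ℕ-solve-∀
        P≤κqʲ : P ≤ κ * q ^ j
        P≤κqʲ = *-cancelˡ-≤ q (≤-trans le (≤-reflexive (assoc q κ (q ^ j))))
      rows : (∑ λ v → ⟦ low-rank? {suc i} (suc j) (v ∷ A) ⟧) ≤ ⟦ low-rank? (suc j) A ⟧ * q ^ j + ⟦ low-rank? j A ⟧ * P
      rows = begin
        (∑ λ v → ⟦ low-rank? {suc i} (suc j) (v ∷ A) ⟧)                              ≤⟨ ∑-mono row ⟩
        (∑ λ v → ⟦ flat? v ⟧ * ⟦ low-rank? (suc j) A ⟧ + ⟦ low-rank? j A ⟧)          ≡⟨ ∑-+ {Vec F n} _ _ ⟩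
        (∑ λ v → ⟦ flat? v ⟧ * ⟦ low-rank? (suc j) A ⟧) + ∑ {Vec F n} (λ _ → ⟦ low-rank? j A ⟧)
            ≡⟨ cong₂ _+_ (∑-*ʳ {Vec F n} _ ⟦ low-rank? (suc j) A ⟧)
                 (trans (∑-const {Vec F n} ⟦ low-rank? j A ⟧) (trans (cong (_* ⟦ low-rank? j A ⟧) (card-Vec n)) (*-comm P _))) ⟩
        # flat? * ⟦ low-rank? (suc j) A ⟧ + ⟦ low-rank? j A ⟧ * P                    ≤⟨ +-monoˡ-≤ _ few-flat ⟩
        ⟦ low-rank? (suc j) A ⟧ * q ^ j + ⟦ low-rank? j A ⟧ * P                      ∎

  -- Quadratic forms and their polarisation.

  form : ∀ {n} → Tri F n → Vec F n → F
  form [] [] = 𝟘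
  form (u ∷ U) (x ∷ v) = x ⊗ (u · (x ∷ v)) ⊕ form U v

  prepend : ∀ {i n} → Vec F i → Vec (Vec F n) i → Vec (Vec F (suc n)) i
  prepend = zipWith _∷_

  -- The matrix U + Uᵀ of the polar bilinear form: b serves both as the rest of the first row and as
  -- the rest of the first column.
  symmetrise : ∀ {n} → Tri F n → Vec (Vec F n) n
  symmetrise [] = []
  symmetrise ((a ∷ b) ∷ U) = ((a ⊕ a) ∷ b) ∷ prepend b (symmetrise U)

  mv-prepend : ∀ {i n} (b : Vec F i) (S : Vec (Vec F n) i) h hs v →
    mv (prepend b S) (h ∷ hs) · v ≡ h ⊗ (b · v) ⊕ mv S hs · v
  mv-prepend [] [] h hs [] = sym (trans (⊕-identityʳ _) (⊗-zeroʳ h))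
  mv-prepend (a ∷ b) (s ∷ S) h hs (x ∷ v) =
    trans (cong ((a ⊗ h ⊕ s · hs) ⊗ x ⊕_) (mv-prepend b S h hs v))
      (rearrange a h (s · hs) x (b · v) (mv S hs · v))
    where
    rearrange : ∀ a h s x b m → (a ⊗ h ⊕ s) ⊗ x ⊕ (h ⊗ b ⊕ m) ≡ h ⊗ (a ⊗ x ⊕ b) ⊕ (s ⊗ x ⊕ m)
    rearrange = solve 6 (λ a h s x b m →
      (a :* h :+ s) :* x :+ (h :* b :+ m) := h :* (a :* x :+ b) :+ (s :* x :+ m)) refl

  -- The increment under a shift by h is grouped as an affine function of x, with linear part (U +
  -- Uᵀ) h and constant part `form U h`, as the differencing argument needs it.
  polarisation : ∀ {n} (U : Tri F n) x h →
    form U (x +[ 𝟙 ] h) ≡ form U x ⊕ (mv (symmetrise U) h · x ⊕ form U h)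
  polarisation [] [] [] = sym (trans (⊕-identityˡ _) (⊕-identityˡ 𝟘))
  polarisation ((a ∷ b) ∷ U) (x ∷ v) (h ∷ w) = begin
    form ((a ∷ b) ∷ U) ((x ∷ v) +[ 𝟙 ] (h ∷ w))
      ≡⟨ cong₂ (λ y z → (x ⊕ 𝟙 ⊗ h) ⊗ (a ⊗ (x ⊕ 𝟙 ⊗ h) ⊕ y) ⊕ z) (·-+[] b v 𝟙 w) (polarisation U v w) ⟩
    (x ⊕ 𝟙 ⊗ h) ⊗ (a ⊗ (x ⊕ 𝟙 ⊗ h) ⊕ (b · v ⊕ 𝟙 ⊗ (b · w))) ⊕ (form U v ⊕ (mv (symmetrise U) w · v ⊕ form U w))
      ≡⟨ rearrange a x h (b · v) (b · w) (form U v) (form U w) (mv (symmetrise U) w · v) ⟩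
    (x ⊗ (a ⊗ x ⊕ b · v) ⊕ form U v) ⊕
      ((((a ⊕ a) ⊗ h ⊕ b · w) ⊗ x ⊕ (h ⊗ (b · v) ⊕ mv (symmetrise U) w · v)) ⊕ (h ⊗ (a ⊗ h ⊕ b · w) ⊕ form U w))
      ≡⟨ cong (λ y → (x ⊗ (a ⊗ x ⊕ b · v) ⊕ form U v) ⊕
           ((((a ⊕ a) ⊗ h ⊕ b · w) ⊗ x ⊕ y) ⊕ (h ⊗ (a ⊗ h ⊕ b · w) ⊕ form U w))) (mv-prepend b (symmetrise U) h w v) ⟨
    form ((a ∷ b) ∷ U) (x ∷ v) ⊕ (mv (symmetrise ((a ∷ b) ∷ U)) (h ∷ w) · (x ∷ v) ⊕ form ((a ∷ b) ∷ U) (h ∷ w)) ∎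
    where
    open ≡-Reasoning
    rearrange : ∀ a x h p r f g m →
      (x ⊕ 𝟙 ⊗ h) ⊗ (a ⊗ (x ⊕ 𝟙 ⊗ h) ⊕ (p ⊕ 𝟙 ⊗ r)) ⊕ (f ⊕ (m ⊕ g)) ≡
      (x ⊗ (a ⊗ x ⊕ p) ⊕ f) ⊕ ((((a ⊕ a) ⊗ h ⊕ r) ⊗ x ⊕ (h ⊗ p ⊕ m)) ⊕ (h ⊗ (a ⊗ h ⊕ r) ⊕ g))
    rearrange = solve 8 (λ a x h p r f g m →
      (x :+ con 1 :* h) :* (a :* (x :+ con 1 :* h) :+ (p :+ con 1 :* r)) :+ (f :+ (m :+ g)) := (x :* (a :* x :+ p) :+ f) :+ ((((a :+ a) :* h :+ r) :* x :+ (h :* p :+ m)) :+ (h :* (a :* h :+ r) :+ g))) refl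

  prepend-injective : ∀ {i n} (b : Vec F i) {S S′ : Vec (Vec F n) i} →
    prepend b S ≡ prepend b S′ → S ≡ S′
  prepend-injective [] {[]} {[]} _ = refl
  prepend-injective (a ∷ b) {s ∷ S} {s′ ∷ S′} e =
    cong₂ _∷_ (Vec.∷-injectiveʳ (Vec.∷-injectiveˡ e)) (prepend-injective b (Vec.∷-injectiveʳ e))

  module _ (2≢0 : 𝟙 ⊕ 𝟙 ≢ 𝟘) where

    double-injective : ∀ {a b} → a ⊕ a ≡ b ⊕ b → a ≡ b
    double-injective {a} {b} e with inverse 2≢0
    ... | t , t2≡1 = trans (sym (halve a)) (trans (cong (t ⊗_) e) (halve b))
      where
      halve : ∀ a → t ⊗ (a ⊕ a) ≡ a
      halve a = trans (rearrange t a) (trans (cong (_⊗ a) t2≡1) (⊗-identityˡ a))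
        where
        rearrange : ∀ t a → t ⊗ (a ⊕ a) ≡ t ⊗ (𝟙 ⊕ 𝟙) ⊗ a
        rearrange = solve 2 (λ t a →
          t :* (a :+ a) := t :* (con 1 :+ con 1) :* a) refl

    -- Entries off the diagonal are read off directly, while the diagonal appears doubled and has to
    -- be halved. This is where odd characteristic enters.
    symmetrise-injective : ∀ {n} {U V : Tri F n} → symmetrise U ≡ symmetrise V → U ≡ V
    symmetrise-injective {U = []} {[]} _ = refl
    symmetrise-injective {U = (a ∷ b) ∷ U} {(a′ ∷ b′) ∷ V} e with Vec.∷-injective e
    ... | e₁ , e₂ with Vec.∷-injective e₁
    ... | ea , refl = cong₂ (λ a (W : Tri F _) → (a ∷ b) ∷ W) (double-injective ea) (symmetrise-injective (prepend-injective b e₂))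

  -- Distribution of the values of a single form.

  module _ {n : ℕ} (U : Tri F n) where

    private
      P : ℕ
      P = q ^ n

    fibre : F → ℕ
    fibre a = # λ x → form U x ≟ a

    ∑-fibre : ∑ fibre ≡ P
    ∑-fibre = begin
      ∑ fibre                                      ≡⟨ ∑-comm _ ⟩
      ∑ (λ x → ∑ λ a → ⟦ form U x ≟ a ⟧)           ≡⟨ ∑-cong (λ x → ∑-cong λ a → ⟦⟧-cong (form U x ≟ a) (a ≟ form U x) sym sym) ⟩
      ∑ (λ x → ∑ λ a → ⟦ a ≟ form U x ⟧)           ≡⟨ ∑-cong (λ x → ∑-once (form U x)) ⟩
      card (Vec F n)                               ≡⟨ card-Vec n ⟩
      P                                            ∎
      where open ≡-Reasoning

    -- Weyl differencing: for a fixed shift h, form U (x + h) ≡ form U x is an affine condition on x.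
    ∑-fibre² : q * ∑ (λ a → fibre a * fibre a) ≤ P * P + nullity (symmetrise U) * (q * P)
    ∑-fibre² = begin
      q * ∑ (λ a → fibre a * fibre a)
        ≡⟨ cong (q *_) (∑-cong λ a → ∑-*ʳ (λ x → ⟦ form U x ≟ a ⟧) (fibre a)) ⟨
      q * ∑ (λ a → ∑ λ x → ⟦ form U x ≟ a ⟧ * fibre a)
        ≡⟨ cong (q *_) (∑-comm _) ⟩
      q * ∑ (λ x → ∑ λ a → ⟦ form U x ≟ a ⟧ * fibre a)
        ≡⟨ cong (q *_) (∑-cong λ x → trans
             (∑-cong λ a → cong (_* fibre a) (⟦⟧-cong (form U x ≟ a) (a ≟ form U x) sym sym))
             (∑-δ fibre (form U x))) ⟩
      q * ∑ (λ x → fibre (form U x))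
        ≤⟨ *-monoʳ-≤ q (∑-mono shift) ⟩
      -- Pairs (x, y) on which the form agrees are now parametrised by x and h = y - x; by
      -- polarisation, `stable? x h` is the equation form U (x + h) = form U x.
      q * ∑ (λ x → # (stable? x))
        ≡⟨ cong (q *_) (∑-comm _) ⟩
      q * ∑ (λ h → # (λ x → stable? x h))
        ≡⟨ ∑-*ˡ q _ ⟨
      ∑ (λ h → q * # (λ x → stable? x h))
        ≤⟨ ∑-mono stable-count ⟩
      ∑ (λ h → P + ⟦ inKer? S h ⟧ * (q * P))
        ≡⟨ ∑-+ _ _ ⟩
      ∑ {Vec F n} (λ h → P) + ∑ (λ h → ⟦ inKer? S h ⟧ * (q * P))
        ≡⟨ cong₂ _+_ (trans (∑-const {Vec F n} P) (cong (_* P) (card-Vec n))) (∑-*ʳ _ (q * P)) ⟩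
      P * P + nullity S * (q * P) ∎
      where
      open ≤-Reasoning
      S : Vec (Vec F n) n
      S = symmetrise U
      stable? : ∀ x h → Dec (mv S h · x ≡ ⊖ form U h)
      stable? x h = mv S h · x ≟ ⊖ form U h
      x+[y-x] : ∀ {n} (x y : Vec F n) → x +[ 𝟙 ] (y +[ ⊖ 𝟙 ] x) ≡ y
      x+[y-x] [] [] = refl
      x+[y-x] (a ∷ x) (b ∷ y) = cong₂ _∷_ (trans (rearrange a b (⊖ 𝟙))
          (trans (cong (λ z → z ⊗ a ⊕ b) (⊖-inverseʳ 𝟙)) (trans (cong (_⊕ b) (⊗-zeroˡ a)) (⊕-identityˡ b)))) (x+[y-x] x y)
        where
        rearrange : ∀ a b m → a ⊕ 𝟙 ⊗ (b ⊕ m ⊗ a) ≡ (𝟙 ⊕ m) ⊗ a ⊕ b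
        rearrange = solve 3 (λ a b m →
          a :+ con 1 :* (b :+ m :* a) := (con 1 :+ m) :* a :+ b) refl
      shift : ∀ x → fibre (form U x) ≤ # (stable? x)
      shift x = #-inject (λ y → form U y ≟ form U x) (stable? x) (_+[ ⊖ 𝟙 ] x) (+[]-cancel (⊖ 𝟙) x) λ y e →
        let h = y +[ ⊖ 𝟙 ] x
            z≡0 : mv S h · x ⊕ form U h ≡ 𝟘
            z≡0 = ⊕-cancelˡ (form U x) _ 𝟘 (trans (sym (polarisation U x h))
                    (trans (cong (form U) (x+[y-x] x y)) (trans e (sym (⊕-identityʳ _)))))
        in ⊕-cancelʳ (form U h) _ _ (trans z≡0 (sym (⊖-inverseˡ (form U h))))
      stable-count : ∀ h → q * # (λ x → stable? x h) ≤ P + ⟦ inKer? S h ⟧ * (q * P)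
      stable-count h with inKer? S h
      ... | no ne = ≤-trans (≤-reflexive (hyperplane (mv S h) ne (⊖ form U h))) (m≤m+n P 0)
      ... | yes _ = ≤-trans (*-monoʳ-≤ q (≤-trans (∑-mono λ x → ⟦⟧≤1 (stable? x h)) (≤-reflexive (card-Vec n))))
                     (≤-trans (≤-reflexive (sym (+-identityʳ (q * P)))) (m≤n+m _ P))

    -- The variance of fibre bounds the deviation of each single value.
    fibre-deviation : ∀ a e → q * fibre a ≡ P + e → e * e ≤ nullity (symmetrise U) * (q * q * P)
    fibre-deviation a₀ e dev = +-cancelˡ-≤ (2 * (q * P * P)) _ _ (begin
      2 * (q * P * P) + e * e
        ≡⟨ cong (λ z → 2 * (q * z * P) + e * e) ∑-fibre ⟨
      2 * (q * ∑ fibre * P) + e * e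
        ≡⟨ cong₂ _+_ (trans (pull q (∑ fibre) P) (sym (∑-*ʳ fibre (2 * q * P)))) (sym (∑-δ (λ _ → e * e) a₀)) ⟩
      ∑ (λ a → fibre a * (2 * q * P)) + ∑ (λ a → ⟦ a ≟ a₀ ⟧ * (e * e))
        ≡⟨ ∑-+ _ _ ⟨
      ∑ (λ a → fibre a * (2 * q * P) + ⟦ a ≟ a₀ ⟧ * (e * e))
        ≤⟨ ∑-mono square ⟩
      ∑ (λ a → q * fibre a * (q * fibre a) + P * P)
        ≡⟨ ∑-+ _ _ ⟩
      ∑ (λ a → q * fibre a * (q * fibre a)) + ∑ {F} (λ _ → P * P)
        ≡⟨ cong₂ _+_ (trans (∑-cong λ a → regroup q (fibre a)) (∑-*ˡ (q * q) _)) (∑-const {F} (P * P)) ⟩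
      q * q * ∑ (λ a → fibre a * fibre a) + q * (P * P)
        ≡⟨ cong (_+ q * (P * P)) (*-assoc q q _) ⟩
      q * (q * ∑ (λ a → fibre a * fibre a)) + q * (P * P)
        ≤⟨ +-monoˡ-≤ _ (*-monoʳ-≤ q ∑-fibre²) ⟩
      q * (P * P + κ * (q * P)) + q * (P * P)
        ≡⟨ collect q P κ ⟩
      2 * (q * P * P) + κ * (q * q * P) ∎)
      where
      open ≤-Reasoning
      κ : ℕ
      κ = nullity (symmetrise U)
      pull : ∀ q s P → 2 * (q * s * P) ≡ s * (2 * q * P)
      pull = ℕ-solve-∀
      pull′ : ∀ q s P → 2 * (q * s * P) ≡ s * (2 * q * P) + 0
      pull′ = ℕ-solve-∀
      regroup : ∀ q s → q * s * (q * s) ≡ q * q * (s * s)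
      regroup = ℕ-solve-∀
      collect : ∀ q P κ → q * (P * P + κ * (q * P)) + q * (P * P) ≡ 2 * (q * P * P) + κ * (q * q * P)
      collect = ℕ-solve-∀
      -- Says (q · fibre a - P)² ≥ 0 for general a, while at a₀ the square is kept as e². Summed
      -- over a, it bounds e² by the whole variance.
      square : ∀ a → fibre a * (2 * q * P) + ⟦ a ≟ a₀ ⟧ * (e * e) ≤ q * fibre a * (q * fibre a) + P * P
      square a with a ≟ a₀
      ... | no _ = ≤-trans (≤-reflexive (sym (pull′ q (fibre a) P))) (2*m*n≤m²+n² (q * fibre a) P)
      ... | yes refl = ≤-reflexive (trans (cong₂ _+_ (sym (pull q (fibre a) P)) (+-identityʳ (e * e)))
              (subst (λ z → 2 * (z * P) + e * e ≡ z * z + P * P) (sym dev) (sym (square-expand P e))))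

    -- Only an excess e of q · fibre 𝟘 over P matters, so truncated subtraction is harmless. The
    -- deviation bound gives e² ≤ κ q² P, and the hypothesis turns this into (e T)² ≤ P².
    zeros-bound : ∀ T → nullity (symmetrise U) * (q * q * (T * T)) ≤ P → q * fibre 𝟘 * T ≤ P * suc T
    zeros-bound T small with ≤-total (q * fibre 𝟘) P
    ... | inj₁ le = ≤-trans (*-monoˡ-≤ T le) (*-monoʳ-≤ P (n≤1+n T))
    ... | inj₂ P≤ = begin
      q * fibre 𝟘 * T   ≡⟨ cong (_* T) dev ⟩
      (P + e) * T       ≡⟨ *-distribʳ-+ T P e ⟩
      P * T + e * T     ≤⟨ +-monoʳ-≤ (P * T) eT≤P ⟩
      P * T + P         ≡⟨ trans (+-comm (P * T) P) (sym (*-suc P T)) ⟩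
      P * suc T         ∎
      where
      open ≤-Reasoning
      κ e : ℕ
      κ = nullity (symmetrise U)
      e = q * fibre 𝟘 ∸ P
      dev : q * fibre 𝟘 ≡ P + e
      dev = sym (m+[n∸m]≡n P≤)
      regroup : ∀ e T → e * T * (e * T) ≡ e * e * (T * T)
      regroup = ℕ-solve-∀
      regroup′ : ∀ κ q P T → κ * (q * q * P) * (T * T) ≡ κ * (q * q * (T * T)) * P
      regroup′ = ℕ-solve-∀
      eT≤P : e * T ≤ P
      eT≤P = m²≤n²⇒m≤n (begin
        e * T * (e * T)                   ≡⟨ regroup e T ⟩
        e * e * (T * T)                   ≤⟨ *-monoˡ-≤ (T * T) (fibre-deviation 𝟘 e dev) ⟩
        κ * (q * q * P) * (T * T)         ≡⟨ regroup′ κ q P T ⟩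
        κ * (q * q * (T * T)) * P         ≤⟨ *-monoˡ-≤ P small ⟩
        P * P                             ∎)

  -- Evaluation of all forms at a fixed tuple.

  infixl 6 _+ᵗ[_]_
  _+ᵗ[_]_ : ∀ {n} → Tri F n → F → Tri F n → Tri F n
  [] +ᵗ[ t ] [] = []
  (u ∷ U) +ᵗ[ t ] (v ∷ V) = (u +[ t ] v) ∷ (U +ᵗ[ t ] V)

  +ᵗ[]-cancel : ∀ {n} t (V : Tri F n) {U U′} → U +ᵗ[ t ] V ≡ U′ +ᵗ[ t ] V → U ≡ U′
  +ᵗ[]-cancel t [] {[]} {[]} _ = refl
  +ᵗ[]-cancel t (v ∷ V) {u ∷ U} {u′ ∷ U′} e with ∷-injectiveᵗ e
  ... | e₁ , e₂ = cong₂ _∷_ (+[]-cancel t v e₁) (+ᵗ[]-cancel t V e₂)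

  form-+ᵗ[] : ∀ {n} (U : Tri F n) t V x → form (U +ᵗ[ t ] V) x ≡ form U x ⊕ t ⊗ form V x
  form-+ᵗ[] [] t [] [] = sym (trans (cong (𝟘 ⊕_) (⊗-zeroʳ t)) (⊕-identityʳ 𝟘))
  form-+ᵗ[] (u ∷ U) t (v ∷ V) (x ∷ xs) = trans
    (cong₂ (λ a b → x ⊗ a ⊕ b)
      (trans (·-comm (u +[ t ] v) (x ∷ xs)) (trans (·-+[] (x ∷ xs) u t v)
        (cong₂ (λ a b → a ⊕ t ⊗ b) (·-comm (x ∷ xs) u) (·-comm (x ∷ xs) v))))
      (form-+ᵗ[] U t V xs))
    (rearrange x (u · (x ∷ xs)) t (v · (x ∷ xs)) (form U xs) (form V xs))
    where
    rearrange : ∀ x a t b f g → x ⊗ (a ⊕ t ⊗ b) ⊕ (f ⊕ t ⊗ g) ≡ (x ⊗ a ⊕ f) ⊕ t ⊗ (x ⊗ b ⊕ g)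
    rearrange = solve 6 (λ x a t b f g →
      x :* (a :+ t :* b) :+ (f :+ t :* g) := (x :* a :+ f) :+ t :* (x :* b :+ g)) refl

  eval : ∀ {n m} → Tri F n → Vec (Vec F n) m → Vec F m
  eval U = Vec.map (form U)

  eval-+ᵗ[] : ∀ {n m} (U : Tri F n) t V (ds : Vec (Vec F n) m) → eval (U +ᵗ[ t ] V) ds ≡ eval U ds +[ t ] eval V ds
  eval-+ᵗ[] U t V [] = refl
  eval-+ᵗ[] U t V (d ∷ ds) = cong₂ _∷_ (form-+ᵗ[] U t V d) (eval-+ᵗ[] U t V ds)

  x-x≡0 : ∀ {n} (x : Vec F n) → x +[ ⊖ 𝟙 ] x ≡ 0ᵛ
  x-x≡0 [] = refl
  x-x≡0 (a ∷ x) = cong₂ _∷_ (trans (rearrange a (⊖ 𝟙))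
      (trans (cong (_⊗ a) (⊖-inverseʳ 𝟙)) (⊗-zeroˡ a))) (x-x≡0 x)
    where
    rearrange : ∀ a m → a ⊕ m ⊗ a ≡ (𝟙 ⊕ m) ⊗ a
    rearrange = solve 2 (λ a m → a :+ m :* a := (con 1 :+ m) :* a) refl

  x+y-x≡y : ∀ {n} (x y : Vec F n) → (x +[ 𝟙 ] y) +[ ⊖ 𝟙 ] x ≡ y
  x+y-x≡y [] [] = refl
  x+y-x≡y (a ∷ x) (b ∷ y) = cong₂ _∷_ (trans (rearrange a b (⊖ 𝟙))
      (trans (cong (λ z → z ⊗ a ⊕ b) (⊖-inverseʳ 𝟙)) (trans (cong (_⊕ b) (⊗-zeroˡ a)) (⊕-identityˡ b)))) (x+y-x≡y x y)
    where
    rearrange : ∀ a b m → a ⊕ 𝟙 ⊗ b ⊕ m ⊗ a ≡ (𝟙 ⊕ m) ⊗ a ⊕ b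
    rearrange = solve 3 (λ a b m → a :+ con 1 :* b :+ m :* a := (con 1 :+ m) :* a :+ b) refl

  y-x+x≡y : ∀ {n} (x y : Vec F n) → (y +[ ⊖ 𝟙 ] x) +[ 𝟙 ] x ≡ y
  y-x+x≡y [] [] = refl
  y-x+x≡y (a ∷ x) (b ∷ y) = cong₂ _∷_ (trans (rearrange a b (⊖ 𝟙))
      (trans (cong (λ z → z ⊗ a ⊕ b) (⊖-inverseʳ 𝟙)) (trans (cong (_⊕ b) (⊗-zeroˡ a)) (⊕-identityˡ b)))) (y-x+x≡y x y)
    where
    rearrange : ∀ a b m → b ⊕ m ⊗ a ⊕ 𝟙 ⊗ a ≡ (𝟙 ⊕ m) ⊗ a ⊕ b
    rearrange = solve 3 (λ a b m → b :+ m :* a :+ con 1 :* a := (con 1 :+ m) :* a :+ b) refl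

  module _ {n m : ℕ} (ds : Vec (Vec F n) m) where

    solutions : Vec F m → ℕ
    solutions y = # λ U → eval U ds ≟ y

    vanishing : ℕ
    vanishing = solutions 0ᵛ

    -- Evaluation is linear in the form, so subtracting one solution embeds a nonempty fibre into
    -- the kernel.
    solutions≤ : ∀ y → solutions y ≤ vanishing
    solutions≤ y with search (λ U → eval U ds ≟ y)
    ... | inj₁ (V , V↦y) = #-inject (λ U → eval U ds ≟ y) (λ U → eval U ds ≟ 0ᵛ) (_+ᵗ[ ⊖ 𝟙 ] V) (+ᵗ[]-cancel (⊖ 𝟙) V)
          λ U U↦y → trans (eval-+ᵗ[] U (⊖ 𝟙) V ds) (trans (cong₂ _+[ ⊖ 𝟙 ]_ U↦y V↦y) (x-x≡0 y))
    ... | inj₂ none = ≤-trans (≤-reflexive (trans (∑-cong λ U → ⟦⟧-no (eval U ds ≟ y) (none U)) ∑-zero)) z≤n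

    -- Two nonempty fibres whose targets differ by v would yield a preimage of v.
    solutions₂≤ : ∀ {v} → (∀ U → eval U ds ≢ v) → ∀ y → solutions y + solutions (y +[ 𝟙 ] v) ≤ vanishing
    solutions₂≤ {v} missed y with search (λ U → eval U ds ≟ y)
    ... | inj₂ none = ≤-trans (≤-reflexive (cong (_+ solutions (y +[ 𝟙 ] v))
            (trans (∑-cong λ U → ⟦⟧-no (eval U ds ≟ y) (none U)) ∑-zero))) (solutions≤ (y +[ 𝟙 ] v))
    ... | inj₁ (V , V↦y) = ≤-trans (≤-reflexive (trans
            (cong (solutions y +_) (trans (∑-cong λ U → ⟦⟧-no (eval U ds ≟ y +[ 𝟙 ] v) (none U)) ∑-zero))
            (+-identityʳ (solutions y)))) (solutions≤ y)
      where
      none : ∀ U → eval U ds ≢ y +[ 𝟙 ] v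
      none U e = missed (U +ᵗ[ ⊖ 𝟙 ] V)
        (trans (eval-+ᵗ[] U (⊖ 𝟙) V ds) (trans (cong₂ _+[ ⊖ 𝟙 ]_ e V↦y) (x+y-x≡y y v)))

    ∑-solutions : ∑ solutions ≡ card (Tri F n)
    ∑-solutions = trans (∑-comm {Vec F m} {Tri F n} λ y U → ⟦ eval U ds ≟ y ⟧) (∑-cong λ U →
      trans (∑-cong λ y → ⟦⟧-cong (eval U ds ≟ y) (y ≟ eval U ds) sym sym) (∑-once (eval U ds)))

    vanishing-bound : card (Tri F n) ≤ q ^ m * vanishing
    vanishing-bound = begin
      card (Tri F n)                   ≡⟨ ∑-solutions ⟨
      ∑ solutions                      ≤⟨ ∑-mono solutions≤ ⟩
      ∑ {Vec F m} (λ _ → vanishing)    ≡⟨ trans (∑-const {Vec F m} vanishing) (cong (_* vanishing) (card-Vec m)) ⟩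
      q ^ m * vanishing                ∎
      where open ≤-Reasoning

    -- Both y and y + v run through all targets, so summing the bound for such pairs counts every
    -- form twice. This gives the factor 2 without knowing that a proper subspace has index at least
    -- q.
    vanishing-bound₂ : ∀ {v} → (∀ U → eval U ds ≢ v) → card (Tri F n) + card (Tri F n) ≤ q ^ m * vanishing
    vanishing-bound₂ {v} missed = begin
      card (Tri F n) + card (Tri F n)                  ≡⟨ cong₂ _+_ ∑-solutions ∑-solutions ⟨
      ∑ solutions + ∑ solutions                        ≤⟨ +-monoʳ-≤ (∑ solutions) translate ⟩
      ∑ solutions + ∑ (λ y → solutions (y +[ 𝟙 ] v))   ≡⟨ ∑-+ solutions _ ⟨
      ∑ (λ y → solutions y + solutions (y +[ 𝟙 ] v))   ≤⟨ ∑-mono (solutions₂≤ missed) ⟩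
      ∑ {Vec F m} (λ _ → vanishing)                    ≡⟨ trans (∑-const {Vec F m} vanishing) (cong (_* vanishing) (card-Vec m)) ⟩
      q ^ m * vanishing                                ∎
      where
      open ≤-Reasoning
      translate : ∑ solutions ≤ ∑ (λ y → solutions (y +[ 𝟙 ] v))
      translate = ≤-trans (≤-reflexive (∑-cong λ y → cong solutions (sym (y-x+x≡y v y))))
        (∑-inject (_+[ ⊖ 𝟙 ] v) (+[]-cancel (⊖ 𝟙) v) (λ y → solutions (y +[ 𝟙 ] v)))

  -- The entries of a tuple vary independently once the form is fixed; this is why m-th moments of
  -- the zero count appear.
  zero-tuples : ∀ {n} (U : Tri F n) m → # (λ (ds : Vec (Vec F n) m) → eval U ds ≟ 0ᵛ) ≡ fibre U 𝟘 ^ m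
  zero-tuples U zero = trans (∑-[] _) (⟦⟧-yes (eval U [] ≟ 0ᵛ) refl)
  zero-tuples {n} U (suc m) = begin
    # (λ (ds : Vec (Vec F n) (suc m)) → eval U ds ≟ 0ᵛ)
      ≡⟨ ∑-∷ _ ⟩
    ∑ (λ d → ∑ λ (ds : Vec (Vec F n) m) → ⟦ eval U (d ∷ ds) ≟ 0ᵛ ⟧)
      ≡⟨ ∑-cong (λ d → ∑-cong λ ds → ⟦⟧-× (form U d ≟ 𝟘) (eval U ds ≟ 0ᵛ) (eval U (d ∷ ds) ≟ 0ᵛ) Vec.∷-injective (cong₂ _∷_)) ⟩
    ∑ (λ d → ∑ λ (ds : Vec (Vec F n) m) → ⟦ form U d ≟ 𝟘 ⟧ * ⟦ eval U ds ≟ 0ᵛ ⟧)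
      ≡⟨ ∑-cong (λ d → ∑-*ˡ ⟦ form U d ≟ 𝟘 ⟧ _) ⟩
    ∑ (λ d → ⟦ form U d ≟ 𝟘 ⟧ * # (λ (ds : Vec (Vec F n) m) → eval U ds ≟ 0ᵛ))
      ≡⟨ ∑-*ʳ _ _ ⟩
    fibre U 𝟘 * # (λ (ds : Vec (Vec F n) m) → eval U ds ≟ 0ᵛ)
      ≡⟨ cong (fibre U 𝟘 *_) (zero-tuples U m) ⟩
    fibre U 𝟘 ^ suc m ∎
    where open ≡-Reasoning

  -- Double counting of the pairs of a tuple and a form vanishing on it: summing over tuples first
  -- reduces the problem to zero counts of single forms.
  ∑-vanishing : ∀ n m → q ^ m * ∑ (vanishing {n} {m}) ≡ ∑ λ (U : Tri F n) → (q * fibre U 𝟘) ^ m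
  ∑-vanishing n m = trans (cong (q ^ m *_) (trans (∑-comm {Vec (Vec F n) m} {Tri F n} λ ds U → ⟦ eval U ds ≟ 0ᵛ ⟧)
      (∑-cong λ U → zero-tuples U m)))
    (trans (sym (∑-*ˡ {Tri F n} (q ^ m) _)) (∑-cong λ U → sym (^-distribʳ-* m q (fibre U 𝟘))))

  -- The moment estimate and the number of bad tuples.

  degenerate : ℕ → ℕ → ℕ
  degenerate n j = # λ (U : Tri F n) → low-rank? j (symmetrise U)

  module _ {n : ℕ} (m j T : ℕ) (T-small : q * q * q * (T * T) ≤ q ^ j) where

    private
      P X : ℕ
      P = q ^ n
      X = card (Tri F n)

    -- Forms of rank at least j obey `zeros-bound`; for the others the number of zeros is bounded by
    -- the number P of all points, which costs a factor q^m.
    zeros-moment : ∑ (λ (U : Tri F n) → (q * fibre U 𝟘) ^ m) * T ^ m ≤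
      X * (P ^ m * suc T ^ m) + degenerate n j * (q ^ m * P ^ m * T ^ m)
    zeros-moment = begin
      ∑ (λ (U : Tri F n) → (q * fibre U 𝟘) ^ m) * T ^ m
        ≡⟨ ∑-*ʳ {Tri F n} _ (T ^ m) ⟨
      ∑ (λ (U : Tri F n) → (q * fibre U 𝟘) ^ m * T ^ m)
        ≤⟨ ∑-mono bound ⟩
      ∑ (λ (U : Tri F n) → P ^ m * suc T ^ m + ⟦ low-rank? j (symmetrise U) ⟧ * (q ^ m * P ^ m * T ^ m))
        ≡⟨ ∑-+ {Tri F n} _ _ ⟩
      ∑ {Tri F n} (λ _ → P ^ m * suc T ^ m) + ∑ (λ (U : Tri F n) → ⟦ low-rank? j (symmetrise U) ⟧ * (q ^ m * P ^ m * T ^ m))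
        ≡⟨ cong₂ _+_ (∑-const {Tri F n} _) (∑-*ʳ {Tri F n} _ _) ⟩
      X * (P ^ m * suc T ^ m) + degenerate n j * (q ^ m * P ^ m * T ^ m) ∎
      where
      open ≤-Reasoning
      bound : ∀ U → (q * fibre U 𝟘) ^ m * T ^ m ≤
        P ^ m * suc T ^ m + ⟦ low-rank? j (symmetrise U) ⟧ * (q ^ m * P ^ m * T ^ m)
      bound U with low-rank? j (symmetrise U)
      ... | yes _ = ≤-trans (*-monoˡ-≤ (T ^ m) (≤-trans
              (^-monoˡ-≤ m (*-monoʳ-≤ q (≤-trans (∑-mono λ x → ⟦⟧≤1 (form U x ≟ 𝟘)) (≤-reflexive (card-Vec n)))))
              (≤-reflexive (^-distribʳ-* m q P))))
            (≤-trans (≤-reflexive (sym (+-identityʳ (q ^ m * P ^ m * T ^ m)))) (m≤n+m _ (P ^ m * suc T ^ m)))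
      ... | no high = ≤-trans (≤-reflexive (sym (^-distribʳ-* m (q * fibre U 𝟘) T))) (≤-trans
              (^-monoˡ-≤ m (zeros-bound U T small))
              (≤-trans (≤-reflexive (^-distribʳ-* m P (suc T))) (m≤m+n _ _)))
        where
        κ : ℕ
        κ = nullity (symmetrise U)
        regroup : ∀ q κ S → q * (κ * (q * q * S)) ≡ κ * (q * q * q * S)
        regroup = ℕ-solve-∀
        small : κ * (q * q * (T * T)) ≤ P
        -- High rank means κ q^j < q P. Two of the three factors q in `T-small` are those of
        -- `zeros-bound`, and the third cancels the q on the right.
        small = *-cancelˡ-≤ q (≤-trans (≤-reflexive (regroup q κ (T * T)))
          (≤-trans (*-monoʳ-≤ κ T-small) (<⇒≤ (≰⇒> high))))

  degenerate-count : 𝟙 ⊕ 𝟙 ≢ 𝟘 → ∀ n j → degenerate n j ≤ 2 ^ n * (q ^ j) ^ n * (q ^ n) ^ j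
  degenerate-count 2≢0 n j = ≤-trans
    (#-inject (λ (U : Tri F n) → low-rank? j (symmetrise U)) (low-rank? {n} {n} j) symmetrise
      (symmetrise-injective 2≢0) (λ _ le → le))
    (low-rank-count n n j)

  -- `bad` is left abstract: its hypothesis merges the two kernel bounds, one copy of the space of
  -- forms for every tuple and a second copy for a bad one.
  few-missed : 𝟙 ⊕ 𝟙 ≢ 𝟘 → ∀ k n m → threshold q (2 * suc k) < n →
    m ≤ suc n C 2 → n ^ (11 * n) ≤ q ^ (suc n C 2 ∸ m) →
    (bad : Vec (Vec F n) m → ℕ) →
    (∀ ds → card (Tri F n) + bad ds * card (Tri F n) ≤ q ^ m * vanishing ds) →
    suc k * ∑ bad ≤ (q ^ n) ^ m
  few-missed 2≢0 k n m big m≤C nⁿ≤ bad bad-bound = combine-bounds k X Tot (∑ bad) (∑ moment) (T ^ m) (suc T ^ m)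
      (degenerate n j) (q ^ m) lower (zeros-moment m j T T-small)
      (growth-bound s n m (≤-trans m≤C ([1+n]C2≤n² n))) few
    where
    open ≤-Reasoning
    s T X Tot : ℕ
    s = 2 * suc k
    T = suc s * (n * n)
    X = card (Tri F n)
    Tot = (q ^ n) ^ m
    X≡ : X ≡ q ^ (suc n C 2)
    X≡ = card-Tri n
    moment : Tri F n → ℕ
    moment U = (q * fibre U 𝟘) ^ m
    0<n : 0 < n
    0<n = ≤-<-trans z≤n big
    instance
      n≢0 : NonZero n
      n≢0 = >-nonZero 0<n
      nn≢0 : NonZero (n * n)
      nn≢0 = m*n≢0 n n
      T≢0 : NonZero T
      T≢0 = m*n≢0 (suc s) (n * n)
      Tᵐ≢0 : NonZero (T ^ m)
      Tᵐ≢0 = m^n≢0 T m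
      X≢0 : NonZero X
      X≢0 = >-nonZero (subst (0 <_) (sym X≡) (0<qⁿ (suc n C 2)))
      q²≢0 : NonZero (q * q)
      q²≢0 = m*n≢0 q q
      q³≢0 : NonZero (q * q * q)
      q³≢0 = m*n≢0 (q * q) q
      TT≢0 : NonZero (T * T)
      TT≢0 = m*n≢0 T T
    -- The rank cut-off j has to be large enough for `zeros-moment` and small enough for
    -- `degenerate-negligible`; rounding up to a power of q costs only one factor q.
    exponent : ∃ λ j → q * q * q * (T * T) ≤ q ^ j × q ^ j ≤ q * (q * q * q * (T * T))
    exponent = power-between 1<q (q * q * q * (T * T)) (>-nonZero⁻¹ _ ⦃ m*n≢0 (q * q * q) (T * T) ⦄)
    j : ℕ
    j = proj₁ exponent
    T-small : q * q * q * (T * T) ≤ q ^ j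
    T-small = proj₁ (proj₂ exponent)
    lower : X * (Tot + ∑ bad) ≤ ∑ moment
    lower = begin
      X * (Tot + ∑ bad)                                       ≡⟨ trans (*-distribˡ-+ X Tot (∑ bad)) (cong₂ _+_ (*-comm X Tot) (*-comm X (∑ bad))) ⟩
      Tot * X + ∑ bad * X                                     ≡⟨ cong₂ _+_ (trans (∑-const {Vec (Vec F n) m} X)
                                                                   (cong (_* X) (trans (card-Vec {Vec F n} m) (cong (_^ m) (card-Vec n))))) (∑-*ʳ bad X) ⟨
      ∑ {Vec (Vec F n) m} (λ _ → X) + ∑ (λ ds → bad ds * X)   ≡⟨ ∑-+ {Vec (Vec F n) m} _ _ ⟨
      ∑ (λ ds → X + bad ds * X)                               ≤⟨ ∑-mono bad-bound ⟩
      ∑ (λ ds → q ^ m * vanishing ds)                         ≡⟨ ∑-*ˡ {Vec (Vec F n) m} (q ^ m) vanishing ⟩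
      q ^ m * ∑ (vanishing {n} {m})                           ≡⟨ ∑-vanishing n m ⟩
      ∑ moment                                                ∎
    -- Even with weight q^m each, the degenerate forms make up at most 1/s of all forms: their
    -- number is at most n^(11n) / s, which the assumed gap between m and the binomial coefficient
    -- absorbs.
    few : s * degenerate n j * q ^ m ≤ X
    few = begin
      s * degenerate n j * q ^ m                     ≤⟨ *-monoˡ-≤ (q ^ m) (*-monoʳ-≤ s (degenerate-count 2≢0 n j)) ⟩
      s * (2 ^ n * (q ^ j) ^ n * (q ^ n) ^ j) * q ^ m          ≤⟨ *-monoˡ-≤ (q ^ m) (degenerate-negligible q s n j (<⇒≤ big) 0<n (proj₂ (proj₂ exponent))) ⟩
      n ^ (11 * n) * q ^ m                                     ≤⟨ *-monoˡ-≤ (q ^ m) nⁿ≤ ⟩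
      q ^ (suc n C 2 ∸ m) * q ^ m                              ≡⟨ ^-distribˡ-+-* q (suc n C 2 ∸ m) m ⟨
      q ^ (suc n C 2 ∸ m + m)                                  ≡⟨ cong (q ^_) (m∸n+n≡m m≤C) ⟩
      q ^ (suc n C 2)                                          ≡⟨ X≡ ⟨
      X                                                        ∎

-- Residues modulo p

module Residues (p : ℕ) .{{_ : NonZero p}} where

  ι : ℕ → Fin p
  ι n = fromℕ< (m%n<n n p)

  toℕ-ι : ∀ n → toℕ (ι n) ≡ n % p
  toℕ-ι n = Fin.toℕ-fromℕ< (m%n<n n p)

  ι-cong : ∀ {m n} → m % p ≡ n % p → ι m ≡ ι n
  ι-cong {m} {n} e = Fin.toℕ-injective (trans (toℕ-ι m) (trans e (sym (toℕ-ι n))))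

  ι-injective : ∀ {m n} → ι m ≡ ι n → m % p ≡ n % p
  ι-injective {m} {n} e = trans (sym (toℕ-ι m)) (trans (cong toℕ e) (toℕ-ι n))

  ι-toℕ : ∀ x → ι (toℕ x) ≡ x
  ι-toℕ x = Fin.toℕ-injective (trans (toℕ-ι (toℕ x)) (m<n⇒m%n≡m (Fin.toℕ<n x)))

  ι-p : ι p ≡ ι 0
  ι-p = ι-cong (trans (n%n≡0 p) (sym (m*n%n≡0 0 p)))

  infixl 6 _⊕_
  infixl 7 _⊗_
  infix 8 ⊖_

  _⊕_ _⊗_ : Fin p → Fin p → Fin p
  x ⊕ y = ι (toℕ x + toℕ y)
  x ⊗ y = ι (toℕ x * toℕ y)

  ⊖_ : Fin p → Fin p
  ⊖ x = ι (p ∸ toℕ x)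

  ι-+ : ∀ m n → ι m ⊕ ι n ≡ ι (m + n)
  ι-+ m n = trans (cong₂ (λ a b → ι (a + b)) (toℕ-ι m) (toℕ-ι n))
    (ι-cong {m % p + n % p} (sym (%-distribˡ-+ m n p)))

  ι-* : ∀ m n → ι m ⊗ ι n ≡ ι (m * n)
  ι-* m n = trans (cong₂ (λ a b → ι (a * b)) (toℕ-ι m) (toℕ-ι n))
    (ι-cong {m % p * (n % p)} (sym (%-distribˡ-* m n p)))

  -- Matching on this replaces residues by images of naturals, so that each ring law reduces to the
  -- same law in ℕ.
  residue : ∀ x → ∃ λ n → ι n ≡ x
  residue x = toℕ x , ι-toℕ x

  ⊕-comm : ∀ x y → x ⊕ y ≡ y ⊕ x
  ⊕-comm x y = cong ι (+-comm (toℕ x) (toℕ y))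

  ⊗-comm : ∀ x y → x ⊗ y ≡ y ⊗ x
  ⊗-comm x y = cong ι (*-comm (toℕ x) (toℕ y))

  ⊕-assoc : ∀ x y z → (x ⊕ y) ⊕ z ≡ x ⊕ (y ⊕ z)
  ⊕-assoc x y z with residue x | residue y | residue z
  ... | a , refl | b , refl | c , refl = begin
    (ι a ⊕ ι b) ⊕ ι c   ≡⟨ cong (_⊕ ι c) (ι-+ a b) ⟩
    ι (a + b) ⊕ ι c     ≡⟨ ι-+ (a + b) c ⟩
    ι (a + b + c)       ≡⟨ cong ι (+-assoc a b c) ⟩
    ι (a + (b + c))     ≡⟨ ι-+ a (b + c) ⟨
    ι a ⊕ ι (b + c)     ≡⟨ cong (ι a ⊕_) (ι-+ b c) ⟨
    ι a ⊕ (ι b ⊕ ι c)   ∎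
    where open ≡-Reasoning

  ⊗-assoc : ∀ x y z → (x ⊗ y) ⊗ z ≡ x ⊗ (y ⊗ z)
  ⊗-assoc x y z with residue x | residue y | residue z
  ... | a , refl | b , refl | c , refl = begin
    (ι a ⊗ ι b) ⊗ ι c   ≡⟨ cong (_⊗ ι c) (ι-* a b) ⟩
    ι (a * b) ⊗ ι c     ≡⟨ ι-* (a * b) c ⟩
    ι (a * b * c)       ≡⟨ cong ι (*-assoc a b c) ⟩
    ι (a * (b * c))     ≡⟨ ι-* a (b * c) ⟨
    ι a ⊗ ι (b * c)     ≡⟨ cong (ι a ⊗_) (ι-* b c) ⟨
    ι a ⊗ (ι b ⊗ ι c)   ∎
    where open ≡-Reasoning

  ⊗-distribˡ-⊕ : ∀ x y z → x ⊗ (y ⊕ z) ≡ (x ⊗ y) ⊕ (x ⊗ z)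
  ⊗-distribˡ-⊕ x y z with residue x | residue y | residue z
  ... | a , refl | b , refl | c , refl = begin
    ι a ⊗ (ι b ⊕ ι c)           ≡⟨ cong (ι a ⊗_) (ι-+ b c) ⟩
    ι a ⊗ ι (b + c)             ≡⟨ ι-* a (b + c) ⟩
    ι (a * (b + c))             ≡⟨ cong ι (*-distribˡ-+ a b c) ⟩
    ι (a * b + a * c)           ≡⟨ ι-+ (a * b) (a * c) ⟨
    ι (a * b) ⊕ ι (a * c)       ≡⟨ cong₂ _⊕_ (ι-* a b) (ι-* a c) ⟨
    (ι a ⊗ ι b) ⊕ (ι a ⊗ ι c)   ∎
    where open ≡-Reasoning

  ⊕-identityˡ : ∀ x → ι 0 ⊕ x ≡ x
  ⊕-identityˡ x = trans (cong (ι 0 ⊕_) (sym (ι-toℕ x))) (trans (ι-+ 0 (toℕ x)) (ι-toℕ x))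

  ⊗-identityˡ : ∀ x → ι 1 ⊗ x ≡ x
  ⊗-identityˡ x = trans (cong (ι 1 ⊗_) (sym (ι-toℕ x)))
    (trans (ι-* 1 (toℕ x)) (trans (cong ι (*-identityˡ (toℕ x))) (ι-toℕ x)))

  ⊕-inverseʳ : ∀ x → x ⊕ ⊖ x ≡ ι 0
  ⊕-inverseʳ x = trans (cong (_⊕ ⊖ x) (sym (ι-toℕ x))) (trans (ι-+ (toℕ x) (p ∸ toℕ x))
    (trans (cong ι (m+[n∸m]≡n (<⇒≤ (Fin.toℕ<n x)))) ι-p))

  isCommutativeRing : IsCommutativeRing _≡_ _⊕_ _⊗_ ⊖_ (ι 0) (ι 1)
  isCommutativeRing = record
    { isRing = record
      { +-isAbelianGroup = record
        { isGroup = record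
          { isMonoid = record
            { isSemigroup = record
              { isMagma = record { isEquivalence = isEquivalence ; ∙-cong = cong₂ _⊕_ }
              ; assoc = ⊕-assoc }
            ; identity = ⊕-identityˡ , λ x → trans (⊕-comm x (ι 0)) (⊕-identityˡ x) }
          ; inverse = (λ x → trans (⊕-comm (⊖ x) x) (⊕-inverseʳ x)) , ⊕-inverseʳ
          ; ⁻¹-cong = cong ⊖_ }
        ; comm = ⊕-comm }
      ; *-cong = cong₂ _⊗_
      ; *-assoc = ⊗-assoc
      ; *-identity = ⊗-identityˡ , λ x → trans (⊗-comm x (ι 1)) (⊗-identityˡ x)
      ; distrib = ⊗-distribˡ-⊕ , λ x y z → trans (⊗-comm (y ⊕ z) x)
          (trans (⊗-distribˡ-⊕ x y z) (cong₂ _⊕_ (⊗-comm x y) (⊗-comm x z))) }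
    ; *-comm = ⊗-comm }

  module _ (p-prime : Prime p) where

    1<p : 1 < p
    1<p = nonTrivial⇒n>1 p ⦃ prime⇒nonTrivial p-prime ⦄

    0≢1 : ι 0 ≢ ι 1
    0≢1 e = contradiction (trans (sym (m<n⇒m%n≡m (<-trans (s≤s z≤n) 1<p)))
      (trans (ι-injective e) (m<n⇒m%n≡m 1<p))) λ ()

    2≢0 : ¬ (2 ∣ p) → ι 1 ⊕ ι 1 ≢ ι 0
    2≢0 odd e = odd (subst (2 ∣_) p≡2 (divides 1 refl))
      where
      p∣2 : p ∣ 2
      p∣2 = m%n≡0⇒n∣m 2 p (trans (ι-injective (trans (sym (ι-+ 1 1)) e)) (m*n%n≡0 0 p))
      p≡2 : 2 ≡ p
      p≡2 = ≤-antisym 1<p (∣⇒≤ p∣2)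

    inverse : ∀ {b} → b ≢ ι 0 → ∃ λ t → t ⊗ b ≡ ι 1
    inverse {b} b≢0 with coprime-Bézout (prime⇒coprime p-prime ⦃ b≢0′ ⦄ (Fin.toℕ<n b))
      where
      b≢0′ : NonZero (toℕ b)
      b≢0′ = ≢-nonZero λ e → b≢0 (trans (sym (ι-toℕ b)) (cong ι e))
    ... | Bézout.-+ x y 1+xp≡yb = ι y , (begin
      ι y ⊗ b               ≡⟨ cong (ι y ⊗_) (ι-toℕ b) ⟨
      ι y ⊗ ι (toℕ b)       ≡⟨ ι-* y (toℕ b) ⟩
      ι (y * toℕ b)         ≡⟨ cong ι 1+xp≡yb ⟨
      ι (1 + x * p)         ≡⟨ ι-cong ([m+kn]%n≡m%n 1 x p) ⟩
      ι 1                   ∎)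
      where open ≡-Reasoning
    -- In this case y b is -1 modulo p, so the inverse is -y, represented by (p - 1) y.
    ... | Bézout.+- x y 1+yb≡xp = ι ((p ∸ 1) * y) , (begin
      ι ((p ∸ 1) * y) ⊗ b             ≡⟨ cong (ι ((p ∸ 1) * y) ⊗_) (ι-toℕ b) ⟨
      ι ((p ∸ 1) * y) ⊗ ι (toℕ b)     ≡⟨ ι-* ((p ∸ 1) * y) (toℕ b) ⟩
      ι ((p ∸ 1) * y * toℕ b)         ≡⟨ ι-cong mod ⟩
      ι 1                             ∎)
      where
      open ≡-Reasoning
      c : ℕ
      c = y * toℕ b
      -- (p − 1) c + (1 + c) = 1 + p c, and p divides 1 + c.
      mod : ((p ∸ 1) * y * toℕ b) % p ≡ 1 % p
      mod = begin
        ((p ∸ 1) * y * toℕ b) % p          ≡⟨ [m+kn]%n≡m%n _ x p ⟨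
        ((p ∸ 1) * y * toℕ b + x * p) % p  ≡⟨ cong (_% p) (cong₂ _+_ (*-assoc (p ∸ 1) y (toℕ b)) (sym 1+yb≡xp)) ⟩
        ((p ∸ 1) * c + suc c) % p          ≡⟨ cong (_% p) (trans (+-suc _ c) (cong suc (trans (+-comm _ c)
                                                (cong (_* c) (m+[n∸m]≡n (<⇒≤ 1<p)))))) ⟩
        suc (p * c) % p                    ≡⟨ cong (λ z → suc z % p) (*-comm p c) ⟩
        (1 + c * p) % p                    ≡⟨ [m+kn]%n≡m%n 1 c p ⟩
        1 % p                              ∎

-- Translation to the encoding used in the statement.

module Points (p : ℕ) .{{_ : NonZero p}} (p-prime : Prime p) (odd : ¬ (2 ∣ p)) where

  open Residues p
  open FiniteField (Fin p) _⊕_ _⊗_ ⊖_ (ι 0) (ι 1) isCommutativeRing (inverse p-prime) (0≢1 p-prime)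

  toMatrix : ∀ {n} → Tri (Fin p) n → Matp p n
  toMatrix [] = []
  toMatrix (u ∷ U) = u ∷ Vec.map (ι 0 ∷_) (toMatrix U)

  rowℕ : ∀ {n} → Vec (Fin p) n → Vec (Fin p) n → ℕ
  rowℕ row d = sumV (zipWith _*_ (Vec.map toℕ row) (Vec.map toℕ d))

  ι-rowℕ : ∀ {n} (row d : Vec (Fin p) n) → ι (rowℕ row d) ≡ row · d
  ι-rowℕ [] [] = refl
  ι-rowℕ (x ∷ row) (y ∷ d) = trans (sym (ι-+ (toℕ x * toℕ y) (rowℕ row d))) (cong (x ⊗ y ⊕_) (ι-rowℕ row d))

  -- `toMatrix` fills the part below the diagonal with zeros, and such a zero column contributes
  -- nothing to the sum.
  quadForm-pad : ∀ {i n} (v : Vec ℕ i) (M : Vec (Vec (Fin p) n) i) a (d : Vec (Fin p) n) →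
    sumV (zipWith (λ x row → x * rowℕ row (a ∷ d)) v (Vec.map (ι 0 ∷_) M)) ≡ sumV (zipWith (λ x row → x * rowℕ row d) v M)
  quadForm-pad [] [] a d = refl
  quadForm-pad (x ∷ v) (row ∷ M) a d = cong₂ _+_
    (cong (λ z → x * (z * toℕ a + rowℕ row d)) (trans (toℕ-ι 0) (m*n%n≡0 0 p))) (quadForm-pad v M a d)

  ι-quadForm : ∀ {n} (U : Tri (Fin p) n) d → ι (quadForm (toMatrix U) d) ≡ form U d
  ι-quadForm [] [] = refl
  ι-quadForm (u ∷ U) (x ∷ d) = begin
    ι (toℕ x * rowℕ u (x ∷ d) + sumV (zipWith (λ y row → y * rowℕ row (x ∷ d)) (Vec.map toℕ d) (Vec.map (ι 0 ∷_) (toMatrix U))))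
      ≡⟨ cong (λ z → ι (toℕ x * rowℕ u (x ∷ d) + z)) (quadForm-pad (Vec.map toℕ d) (toMatrix U) x d) ⟩
    ι (toℕ x * rowℕ u (x ∷ d) + quadForm (toMatrix U) d)
      ≡⟨ ι-+ (toℕ x * rowℕ u (x ∷ d)) (quadForm (toMatrix U) d) ⟨
    ι (toℕ x * rowℕ u (x ∷ d)) ⊕ ι (quadForm (toMatrix U) d)
      ≡⟨ cong₂ _⊕_ (sym (ι-* (toℕ x) (rowℕ u (x ∷ d)))) (ι-quadForm U d) ⟩
    (ι (toℕ x) ⊗ ι (rowℕ u (x ∷ d))) ⊕ form U d
      ≡⟨ cong (_⊕ form U d) (cong₂ _⊗_ (ι-toℕ x) (ι-rowℕ u (x ∷ d))) ⟩
    form (u ∷ U) (x ∷ d) ∎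
    where open ≡-Reasoning

  nonzeroQF-true : ∀ {n} (U : Tri (Fin p) n) d → form U d ≡ ι 1 → nonzeroQF p (toMatrix U) d ≡ true
  nonzeroQF-true U d e with quadForm (toMatrix U) d % p in eq
  ... | suc _ = refl
  ... | zero = contradiction (trans (ι-cong (trans (m*n%n≡0 0 p) (sym eq))) (trans (ι-quadForm U d) e)) (0≢1 p-prime)

  1ᵛ : ∀ {m} → Vec (Fin p) m
  1ᵛ = replicate _ (ι 1)

  -- The search over `matrices` runs through `elems`, so a triangular witness is found by it; the
  -- value 1 at every point is one way of being nonzero everywhere.
  goodTuple-true : ∀ {n m} (U : Tri (Fin p) n) (ds : Vec (Vecp p n) m) → eval U ds ≡ 1ᵛ → goodTuple p ds ≡ true
  goodTuple-true {n} U ds e = any-elems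
      (λ M → foldr _ (λ d b → nonzeroQF p M d ∧ b) true ds) (toMatrix U) (all-nonzero ds e)
    where
    all-nonzero : ∀ {m} (ds : Vec (Vecp p n) m) → eval U ds ≡ 1ᵛ →
      foldr _ (λ d b → nonzeroQF p (toMatrix U) d ∧ b) true ds ≡ true
    all-nonzero [] _ = refl
    all-nonzero (d ∷ ds) e = cong₂ _∧_ (nonzeroQF-true U d (Vec.∷-injectiveˡ e)) (all-nonzero ds (Vec.∷-injectiveʳ e))

  bad : ∀ {n m} → Vec (Vecp p n) m → ℕ
  bad ds = if goodTuple p ds then 0 else 1

  -- By contraposition of `goodTuple-true`, evaluation at a bad tuple misses (1,...,1), so the
  -- doubled bound applies to it.
  bad-bound : ∀ {n m} (ds : Vec (Vecp p n) m) → card (Tri (Fin p) n) + bad ds * card (Tri (Fin p) n) ≤ q ^ m * vanishing ds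
  bad-bound {n} {m} ds with goodTuple p ds in eq
  ... | true = ≤-trans (≤-reflexive (+-identityʳ (card (Tri (Fin p) n)))) (vanishing-bound ds)
  ... | false = ≤-trans (≤-reflexive (cong (card (Tri (Fin p) n) +_) (+-identityʳ (card (Tri (Fin p) n)))))
    (vanishing-bound₂ ds {1ᵛ} λ U e → contradiction (trans (sym eq) (goodTuple-true U ds e)) λ ())

  q≡p : q ≡ p
  q≡p = card-Fin p

  totalCount≡ : ∀ n m → totalCount p n m ≡ (q ^ n) ^ m
  totalCount≡ n m = trans (cong (_^ (n * m)) (sym q≡p)) (sym (^-*-assoc q n m))

  opaque
    unfolding ∑

    goodCount+bad : ∀ n m → goodCount p n m + ∑ (bad {n} {m}) ≡ card (Vec (Vecp p n) m)
    goodCount+bad n m = trans (count+cocount (goodTuple p) (vecs (points p n) m)) (sym (∑ₗ-1 (vecs (points p n) m)))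

  total∸good≡bad : ∀ n m → totalCount p n m ∸ goodCount p n m ≡ ∑ (bad {n} {m})
  total∸good≡bad n m = trans (cong (_∸ goodCount p n m) (trans (totalCount≡ n m)
      (trans (sym (trans (card-Vec {Vecp p n} m) (cong (_^ m) (card-Vec n)))) (sym (goodCount+bad n m)))))
    (m+n∸m≡n (goodCount p n m) _)

  few-bad : ∀ k n m → threshold q (2 * suc k) < n → MBound p n m →
    suc k * (totalCount p n m ∸ goodCount p n m) ≤ totalCount p n m
  few-bad k n m big (m≤C , nⁿ≤) = subst₂ _≤_ (cong (suc k *_) (sym (total∸good≡bad n m))) (sym (totalCount≡ n m))
    (few-missed (2≢0 p-prime odd) k n m big m≤C (subst (λ z → n ^ (11 * n) ≤ z ^ (suc n C 2 ∸ m)) (sym q≡p) nⁿ≤) bad bad-bound)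

theorem3p1 : (p : ℕ) .{{_ : NonZero p}} → Prime p → ¬ (2 ∣ p) →
    (m : ℕ → ℕ) → (∃[ n₀ ] (∀ n → n ≥ n₀ → MBound p n (m n))) →
    ∀ k → ∃[ N ] (∀ n → n ≥ N →
    suc k * (totalCount p n (m n) ∸ goodCount p n (m n)) ≤ totalCount p n (m n))
-- The `suc` supplies the strict inequality that `few-bad` asks for, from which 0 < n follows as
-- well.
theorem3p1 p p-prime odd m (n₀ , bound) k = n₀ ⊔ suc (threshold q (2 * suc k)) , λ n n≥ →
    few-bad k n (m n) (≤-trans (m≤n⊔m n₀ _) n≥) (bound n (≤-trans (m≤m⊔n n₀ _) n≥))
  where
  open Points p p-prime odd
  q : ℕ
  q = card (Fin p)
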